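{- For all integers $k\ge 0$ and $n\ge k+2$, $\mathrm{av}_n^k(1324,1432)$ equals the number of partitions of $k$ into blue and red parts such that all blue parts are greater than or equal to all red parts. In particular, $$C_{1324,1432}(x)=\sum_{k\ge 0}(k+1)x^k\cdot\prod_{i=1}^k\frac{1}{1-x^i}.$$
   Context: $\mathrm{av}_n^k(B)$ is the number of permutations in $S_n$ with exactly $k$ inversions (pairs $i<j$ with $\pi_i>\pi_j$) that avoid every pattern in $B$; a permutation avoids a pattern $q$ if it has no subsequence order-isomorphic to $q$. If for every $k\ge0$ there are constants $m_k,c_k(B)$ with $\mathrm{av}_n^k(B)=c_k(B)$ for all $n\ge m_k$, then $(c_k(B))_{k\ge0}$ is the limit sequence of $B$ and $C_B(x)=\sum_{k\ge 0}c_k(B)x^k$ is its limit generating function. A partition of $k$ into blue and red parts is a pair consisting of a partition (multiset) of blue parts and a partition (multiset) of red parts, either possibly empty, with total sum $k$. -}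

module Defs where

open import Data.Fin.Base as Fin using (Fin; zero; suc; toℕ)
open import Data.Fin.Permutation using (Permutation′; transpose; _⟨$⟩ʳ_)
open import Data.Fin.Patterns using (1F; 2F; 3F)
import Data.Fin.Properties as Fin
open import Data.Integer.Base as ℤ using (ℤ; +_; 0ℤ; 1ℤ)
import Data.Integer.Properties as ℤ
open import Data.List.Base
  using (List; []; _∷_; length; filter; allFin; cartesianProduct)
open import Data.List.Relation.Unary.All using (All)
open import Data.Nat.ListAction using (sum)
open import Data.List.Relation.Unary.Linked using (Linked)
open import Data.Nat.Base as ℕ using (ℕ; zero; suc; _∸_)
open import Data.Product.Base using (Σ; _×_; _,_; ∃; proj₁; proj₂)
open import Data.Vec.Base as Vec using (Vec; []; _∷_; tabulate; lookup)
open import Data.Vec.Functional using (foldr)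
open import Function.Bundles using (Inverse; _⇔_)
open import Level using (0ℓ)
open import Relation.Binary.Bundles using (Setoid)
import Relation.Binary.Construct.On as On
open import Relation.Binary.PropositionalEquality
  using (_≡_; _≗_; refl; sym; cong; cong₂; setoid; _→-setoid_; module ≡-Reasoning)
open import Relation.Nullary using (¬_)
open import Relation.Nullary.Decidable using (_×-dec_)
open import Algebra.Properties.Semiring.Sum ℤ.+-*-semiring
  using (sum-syntax; sum⁺-syntax; sum-cong-≗)

-- Membership proofs are ignored when comparing elements of a subset, so that
-- counting a subset counts its elements and not their proofs.
Subset : (S : Setoid 0ℓ 0ℓ) → (Setoid.Carrier S → Set) → Setoid 0ℓ 0ℓ
Subset S P = On.setoid {B = Σ (Setoid.Carrier S) P} S proj₁

HasSize : Setoid 0ℓ 0ℓ → ℕ → Set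
HasSize S m = Inverse S (setoid (Fin m))

-- One-line notation of π: (π ⟨$⟩ʳ 0) (π ⟨$⟩ʳ 1) …, with positions and
-- values both counted from 0.
permutations : ℕ → Setoid 0ℓ 0ℓ
permutations n = On.setoid {B = Permutation′ n} (Fin n →-setoid Fin n) _⟨$⟩ʳ_

inversions : ∀ {n} → Permutation′ n → ℕ
inversions {n} π =
  length (filter (λ (i , j) → (i Fin.<? j) ×-dec ((π ⟨$⟩ʳ j) Fin.<? (π ⟨$⟩ʳ i)))
                 (cartesianProduct (allFin n) (allFin n)))

Pattern : Set
Pattern = ∃ λ m → Permutation′ m

Contains : ∀ {n} → Permutation′ n → Pattern → Set
Contains {n} π (m , q) = ∃ λ (f : Fin m → Fin n) →
  (∀ a b → a Fin.< b → f a Fin.< f b) ×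
  (∀ a b → ((q ⟨$⟩ʳ a) Fin.< (q ⟨$⟩ʳ b)) ⇔ ((π ⟨$⟩ʳ f a) Fin.< (π ⟨$⟩ʳ f b)))

Avoids : ∀ {n} → Permutation′ n → Pattern → Set
Avoids π q = ¬ Contains π q

-- The set counted by avₙᵏ(B).
Av : ℕ → ℕ → List Pattern → Setoid 0ℓ 0ℓ
Av n k B = Subset (permutations n) λ π → inversions π ≡ k × All (Avoids π) B

IsLimitSequence : List Pattern → (ℕ → ℕ) → Set
IsLimitSequence B c =
  ∀ k → ∃ λ mₖ → ∀ n → n ℕ.≥ mₖ → HasSize (Av n k B) (c k)

p1324 p1432 : Pattern
p1324 = 4 , transpose 1F 2F
p1432 = 4 , transpose 1F 3F

_ : tabulate (λ i → suc (toℕ (proj₂ p1324 ⟨$⟩ʳ i))) ≡ 1 ∷ 3 ∷ 2 ∷ 4 ∷ []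
_ = refl

_ : tabulate (λ i → suc (toℕ (proj₂ p1432 ⟨$⟩ʳ i))) ≡ 1 ∷ 4 ∷ 3 ∷ 2 ∷ []
_ = refl

-- A multiset of positive parts, represented by its weakly decreasing listing.
IsPartition : List ℕ → Set
IsPartition ps = Linked ℕ._≥_ ps × All (ℕ._> 0) ps

IsBlueRedPartition : ℕ → List ℕ × List ℕ → Set
IsBlueRedPartition k (blue , red) =
  IsPartition blue × IsPartition red × sum blue ℕ.+ sum red ≡ k

BlueAboveRed : ℕ → Setoid 0ℓ 0ℓ
BlueAboveRed k = Subset (setoid (List ℕ × List ℕ)) λ (blue , red) →
  IsBlueRedPartition k (blue , red) × All (λ b → All (b ℕ.≥_) red) blue

-- Formal power series over ℤ, as coefficient sequences.
Series : Set
Series = ℕ → ℤ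

infixl 6 _⊖_
infixl 7 _⊛_ _·_

𝟏 : Series
𝟏 zero    = 1ℤ
𝟏 (suc _) = 0ℤ

X^_ : ℕ → Series
(X^ zero)  n       = 𝟏 n
(X^ suc k) zero    = 0ℤ
(X^ suc k) (suc n) = (X^ k) n

_⊖_ : Series → Series → Series
(f ⊖ g) n = f n ℤ.- g n

_·_ : ℤ → Series → Series
(a · f) n = a ℤ.* f n

_⊛_ : Series → Series → Series
(f ⊛ g) n = ∑[ i ≤ n ] (f (toℕ i) ℤ.* g (n ∸ toℕ i))

-- Coefficients n, n-1, …, 0 of 1/f, for f with constant term 1.
invPrefix : Series → (n : ℕ) → Vec ℤ (suc n)
invPrefix f zero    = 1ℤ ∷ []
invPrefix f (suc n) =
  ℤ.- (∑[ i ≤ n ] (f (suc (toℕ i)) ℤ.* lookup (invPrefix f n) i)) ∷ invPrefix f n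

-- Meaningful only for f with constant term 1; see ⊛-inv.
inv : Series → Series
inv f n = Vec.head (invPrefix f n)

lookup-invPrefix : ∀ f n (i : Fin (suc n)) →
                   lookup (invPrefix f n) i ≡ inv f (n ∸ toℕ i)
lookup-invPrefix f zero    zero    = refl
lookup-invPrefix f (suc n) zero    = refl
lookup-invPrefix f (suc n) (suc i) = lookup-invPrefix f n i

⊛-inv : ∀ f → f 0 ≡ 1ℤ → f ⊛ inv f ≗ 𝟏
⊛-inv f f₀≡1 zero    = cong (λ a → a ℤ.* 1ℤ ℤ.+ 0ℤ) f₀≡1
⊛-inv f f₀≡1 (suc n) = begin
  f 0 ℤ.* (ℤ.- s) ℤ.+ t   ≡⟨ cong₂ (λ a b → a ℤ.* (ℤ.- s) ℤ.+ b) f₀≡1 t≡s ⟩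
  1ℤ ℤ.* (ℤ.- s) ℤ.+ s    ≡⟨ cong (ℤ._+ s) (ℤ.*-identityˡ (ℤ.- s)) ⟩
  ℤ.- s ℤ.+ s             ≡⟨ ℤ.+-inverseˡ s ⟩
  0ℤ                      ∎
  where
  open ≡-Reasoning
  s t : ℤ
  s = ∑[ i ≤ n ] (f (suc (toℕ i)) ℤ.* lookup (invPrefix f n) i)
  t = ∑[ i ≤ n ] (f (suc (toℕ i)) ℤ.* inv f (n ∸ toℕ i))
  t≡s : t ≡ s
  t≡s = sum-cong-≗ λ i →
    cong (f (suc (toℕ i)) ℤ.*_) (sym (lookup-invPrefix f n i))

-- ∏[ k ] f = f 1 ⊛ f 2 ⊛ … ⊛ f k
∏[_]_ : ℕ → (ℕ → Series) → Series
∏[ k ] f = foldr _⊛_ 𝟏 {k} (λ i → f (suc (toℕ i)))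

-- Convergence of Σ_{k≥0} f k to F in the X-adic topology: each coefficient
-- of the partial sums is eventually constant.
_SumsTo_ : (ℕ → Series) → Series → Set
f SumsTo F = ∀ n → ∃ λ N → ∀ M → M ℕ.≥ N → (∑[ k < M ] f (toℕ k) n) ≡ F n

generatingFunction : (ℕ → ℕ) → Series
generatingFunction c k = + c k

-- Having n ≥ k + 2 forces π to be decomposable, and avoiding 1324 and 1432
-- then means π = σ ⊕ id ⊕ ρ with σ avoiding 132 and ρ avoiding 213 and 321.
-- On Lehmer codes (cᵢ = number of later smaller entries) this reads
--   λ₁ ≥ λ₂ ≥ … , 0 , … , 0 , a , … , a (b times) , 0 , … , 0 (a times),
-- with λ a partition and |λ| + a b = k, which is checked by prepending one
-- entry at a time. Inserting b copies of the part a into λ, colouring them and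
-- all smaller parts red and the other parts blue, gives the coloured
-- partitions: a is the largest red part and b its multiplicity.
--
-- A partition with j parts admits j + 1 colourings, and taking successive
-- differences turns partitions with j parts into partitions with parts of
-- size at most j, the part j occurring at least once.
module Submission where

open import Defs

open import Data.Bool.Base using (if_then_else_; true; false)
open import Data.Fin.Base as Fin using (Fin; zero; suc; toℕ; fromℕ<; punchIn)
open import Data.Fin.Patterns using (0F; 1F; 2F; 3F)
open import Data.Fin.Permutation as Perm
  using (Permutation′; insert; remove; insert-remove; _⟨$⟩ʳ_; _⟨$⟩ˡ_)
import Data.Fin.Properties as Fin
open import Data.Integer.Base as ℤ using (ℤ; 0ℤ; 1ℤ)
import Data.Integer.Properties as ℤ
open import Data.List.Base as List
  using (List; []; _∷_; _++_; length; lookup; filter; map; concatMap; replicate; applyUpTo; upTo; cartesianProduct)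
import Data.List.Properties as List
open import Data.List.Membership.Propositional using (_∈_; find; lose)
open import Data.List.Membership.Propositional.Properties
  using (∈-lookup; ∈-map⁺; ∈-map⁻; ∈-concatMap⁺; ∈-concatMap⁻; ∈-upTo⁺; ∈-upTo⁻)
open import Data.List.Relation.Unary.All as All using (All; []; _∷_)
import Data.List.Relation.Unary.All.Properties as All
open import Data.List.Relation.Unary.AllPairs as AllPairs using (AllPairs; []; _∷_)
import Data.List.Relation.Unary.AllPairs.Properties as AllPairs
open import Data.List.Relation.Unary.Any using (here; there; index)
open import Data.List.Relation.Unary.Any.Properties using (lookup-index)
open import Data.List.Relation.Unary.Linked using (Linked; []; [-]; _∷_)
open import Data.List.Relation.Unary.Linked.Properties using (AllPairs⇒Linked; Linked⇒AllPairs)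
open import Data.List.Relation.Unary.Unique.Propositional using (Unique)
import Data.List.Relation.Unary.Unique.Propositional.Properties as Unique
open import Data.Nat.Base
open import Data.Nat.Divisibility using (_∣_; divides; _∣?_; ∣m+n∣m⇒∣n; ∣m∣n⇒∣m+n; ∣-refl; ∣⇒≤; _∣0)
open import Data.Nat.Induction using (<-rec)
open import Data.Nat.ListAction using (sum)
open import Data.Nat.ListAction.Properties using (sum-++)
open import Data.Nat.Properties
open import Data.Product.Base using (_×_; _,_; ∃; proj₁; proj₂)
import Data.Vec.Base as Vec
open import Data.Vec.Functional using (foldr)
open import Function.Base using (_∘_; id)
open import Function.Bundles using (Inverse; Equivalence; mk⇔; _⇔_)
open import Function.Consequences using (strictlySurjective⇒surjective)
import Function.Construct.Composition as Composition
import Function.Construct.Symmetry as Symmetry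
open import Function.Properties.Bijection using (Bijection⇒Inverse)
open import Level using (0ℓ)
open import Relation.Binary.Bundles using (Setoid)
open import Relation.Binary.Definitions using (tri<; tri≈; tri>)
open import Relation.Binary.PropositionalEquality
open import Relation.Nullary using (Dec; does; yes; no; ¬_; contradiction)
open import Relation.Nullary.Decidable using (_×-dec_; dec-false; does-⇔)
open import Relation.Unary using (Decidable; Pred)
import Algebra.Properties.Semiring.Sum as SemiringSum
open SemiringSum +-*-semiring using (sum-permute) renaming (sum to ∑; sum-cong-≗ to ∑-cong; sum-replicate-zero to ∑-replicate-zero)

-- Lehmer codes

-- Both patterns begin with their smallest letter, so avoidance says that for every entry the later
-- larger entries avoid 213 and 321. For the first entry `c` this is a condition on the values at
-- least `c` of the standardised rest. Hence the thresholds in `AvoidsAbove` and `Follows`: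
-- prepending an entry relabels the values, and the threshold has to move along. The bound `k + 2`
-- has two sources. Removing a nonzero first entry costs one in length and at least one in the sum,
-- so `sum + 2 ≤ n` persists up to the first 0, and while it holds an ascent between neighbouring
-- code entries would squeeze too many values into a short interval. Conversely, the shortest code
-- carrying a given λ and box can need `k + 2` entries: it does when all parts of λ and one side of
-- the box are 1. The triples (λ, a, b) mediate between the two counted sets because they do not
-- mention `n`.

data Code : ℕ → Set where
  []  : Code 0
  _∷_ : ∀ {n} → Fin (suc n) → Code n → Code (suc n)

toList : ∀ {n} → Code n → List ℕ
toList []       = []
toList (c ∷ cs) = toℕ c ∷ toList cs

-- The new first value is `c` and the other values are relabelled to skip it, so exactly `c` later
-- entries are smaller.
decode : ∀ {n} → Code n → Permutation′ n
decode []       = Perm.id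
decode (c ∷ cs) = insert zero c (decode cs)

encode : ∀ {n} (π : Permutation′ n) → ∃ λ (cs : Code n) → decode cs Perm.≈ π
encode {zero}  π = [] , λ ()
encode {suc n} π with encode (remove zero π)
... | cs , p = (π ⟨$⟩ʳ zero) ∷ cs , λ where
  zero    → refl
  (suc i) → trans (cong (punchIn (π ⟨$⟩ʳ zero)) (p i)) (insert-remove zero π (suc i))

decode-injective : ∀ {n} (cs ds : Code n) → decode cs Perm.≈ decode ds → cs ≡ ds
decode-injective []       []       p = refl
decode-injective (c ∷ cs) (d ∷ ds) p with p zero
... | refl = cong (c ∷_) (decode-injective cs ds (λ i → Fin.punchIn-injective c _ _ (p (suc i))))

toList-injective : ∀ {n} (cs ds : Code n) → toList cs ≡ toList ds → cs ≡ ds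
toList-injective []       []       p = refl
toList-injective (c ∷ cs) (d ∷ ds) p =
  cong₂ _∷_ (Fin.toℕ-injective (List.∷-injectiveˡ p)) (toList-injective cs ds (List.∷-injectiveʳ p))

length-toList : ∀ {n} (cs : Code n) → length (toList cs) ≡ n
length-toList []       = refl
length-toList (c ∷ cs) = cong suc (length-toList cs)

-- The lists that are codes. Shapes such as `Good` are stated for plain lists, where `++` and
-- `replicate` carry no length index, and `fromList` returns to `Code`.
data Valid : List ℕ → Set where
  []  : Valid []
  _∷_ : ∀ {x xs} → x ≤ length xs → Valid xs → Valid (x ∷ xs)

fromList : ∀ {n xs} → Valid xs → length xs ≡ n → ∃ λ (cs : Code n) → toList cs ≡ xs
fromList []      refl = [] , refl
fromList (p ∷ v) refl with fromList v refl
... | cs , q = fromℕ< (s≤s p) ∷ cs , cong₂ _∷_ (Fin.toℕ-fromℕ< (s≤s p)) q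

-- Inversions as sums of indicators

⟦_⟧ : ∀ {P : Set} → Dec P → ℕ
⟦ p ⟧ = if does p then 1 else 0

⟦⟧-cong : ∀ {P Q : Set} (p : Dec P) (q : Dec Q) → P ⇔ Q → ⟦ p ⟧ ≡ ⟦ q ⟧
⟦⟧-cong p q P⇔Q = cong (if_then 1 else 0) (does-⇔ P⇔Q p q)

⟦⟧-no : ∀ {P : Set} (p : Dec P) → ¬ P → ⟦ p ⟧ ≡ 0
⟦⟧-no p ¬P = cong (if_then 1 else 0) (dec-false p ¬P)

length-filter : ∀ {n} {A : Set} {P : Pred A _} (P? : Decidable P) (f : Fin n → A) →
                length (filter P? (List.tabulate f)) ≡ ∑ (λ i → ⟦ P? (f i) ⟧)
length-filter {zero}  P? f = refl
length-filter {suc n} P? f with does (P? (f zero))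
... | false = length-filter P? (f ∘ suc)
... | true  = cong suc (length-filter P? (f ∘ suc))

length-filter-× : ∀ {m n} {A B : Set} {P : Pred (A × B) _} (P? : Decidable P) (f : Fin m → A) (g : Fin n → B) →
                  length (filter P? (cartesianProduct (List.tabulate f) (List.tabulate g)))
                    ≡ ∑ (λ i → ∑ (λ j → ⟦ P? (f i , g j) ⟧))
length-filter-× {zero}  P? f g = refl
length-filter-× {suc m} P? f g = begin
  length (filter P? (row ++ rest))                ≡⟨ cong length (List.filter-++ P? row rest) ⟩
  length (filter P? row ++ filter P? rest)        ≡⟨ List.length-++ (filter P? row) ⟩
  length (filter P? row) + length (filter P? rest)
    ≡⟨ cong₂ _+_ (trans (cong (length ∘ filter P?) (List.map-tabulate g (f zero ,_)))
                        (length-filter P? (λ j → f zero , g j)))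
                 (length-filter-× P? (f ∘ suc) g) ⟩
  _ ∎
  where
  open ≡-Reasoning
  row  = map (f zero ,_) (List.tabulate g)
  rest = cartesianProduct (List.tabulate (f ∘ suc)) (List.tabulate g)

inversion? : ∀ {n} (π : Permutation′ n) (i j : Fin n) → Dec (i Fin.< j × (π ⟨$⟩ʳ j) Fin.< (π ⟨$⟩ʳ i))
inversion? π i j = (i Fin.<? j) ×-dec ((π ⟨$⟩ʳ j) Fin.<? (π ⟨$⟩ʳ i))

inversions-∑ : ∀ {n} (π : Permutation′ n) → inversions π ≡ ∑ (λ i → ∑ (λ j → ⟦ inversion? π i j ⟧))
inversions-∑ {n} π = length-filter-× {n} {n} (λ (i , j) → inversion? π i j) id id

∑-zero : ∀ {n} {f : Fin n → ℕ} → f ≗ (λ _ → 0) → ∑ f ≡ 0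
∑-zero {n} p = trans (∑-cong p) (∑-replicate-zero n)

∑-below : ∀ {n} (c : Fin (suc n)) → ∑ (λ (j : Fin n) → ⟦ toℕ j <? toℕ c ⟧) ≡ toℕ c
∑-below {n}     zero    = ∑-zero {n} λ j → ⟦⟧-no (toℕ j <? 0) (λ ())
∑-below {suc n} (suc c) = cong suc (trans
  (∑-cong {n} λ j → ⟦⟧-cong (suc (toℕ j) <? suc (toℕ c)) (toℕ j <? toℕ c) (mk⇔ s<s⁻¹ s<s))
  (∑-below c))

-- The action of `punchIn` on natural numbers, so that values can be compared with thresholds
-- outside `Fin`.
bump : ℕ → ℕ → ℕ
bump zero    v       = suc v
bump (suc c) zero    = zero
bump (suc c) (suc v) = suc (bump c v)

toℕ-punchIn : ∀ {n} (c : Fin (suc n)) (v : Fin n) → toℕ (punchIn c v) ≡ bump (toℕ c) (toℕ v)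
toℕ-punchIn zero    v       = refl
toℕ-punchIn (suc c) zero    = refl
toℕ-punchIn (suc c) (suc v) = cong suc (toℕ-punchIn c v)

bump-mono : ∀ c {v w} → v < w → bump c v < bump c w
bump-mono zero    p             = s<s p
bump-mono (suc c) {zero}  {suc w} p = z<s
bump-mono (suc c) {suc v} {suc w} p = s<s (bump-mono c (s<s⁻¹ p))

bump-cancel : ∀ c {v w} → bump c v < bump c w → v < w
bump-cancel zero    p                   = s<s⁻¹ p
bump-cancel (suc c) {zero}  {suc w} p = z<s
bump-cancel (suc c) {suc v} {suc w} p = s<s (bump-cancel c (s<s⁻¹ p))

bump-low : ∀ {c v} → v < c → bump c v ≡ v
bump-low {suc c} {zero}  p = refl
bump-low {suc c} {suc v} p = cong suc (bump-low (s<s⁻¹ p))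

bump-high : ∀ {c v} → c ≤ v → bump c v ≡ suc v
bump-high {zero}          p = refl
bump-high {suc c} {suc v} p = cong suc (bump-high (s≤s⁻¹ p))

bump-low⁻ : ∀ {c v} → bump c v < c → v < c
bump-low⁻ {suc c} {zero}  p = z<s
bump-low⁻ {suc c} {suc v} p = s<s (bump-low⁻ (s<s⁻¹ p))

bump-high⁻ : ∀ {c v} → c < bump c v → c ≤ v
bump-high⁻ {zero}          p = z≤n
bump-high⁻ {suc c} {suc v} p = s≤s (bump-high⁻ (s<s⁻¹ p))

val : ∀ {n} → Code n → Fin n → ℕ
val cs i = toℕ (decode cs ⟨$⟩ʳ i)

val-suc : ∀ {n} c (cs : Code n) i → val (c ∷ cs) (suc i) ≡ bump (toℕ c) (val cs i)
val-suc c cs i = toℕ-punchIn c (decode cs ⟨$⟩ʳ i)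

-- Inversions at the first position number `toℕ c`. The relabelling is monotone, so the remaining
-- ones are those of the tail.
inversions-decode : ∀ {n} (cs : Code n) → inversions (decode cs) ≡ sum (toList cs)
inversions-decode []               = refl
inversions-decode {suc n} (c ∷ cs) = begin
  inversions π′                                   ≡⟨ inversions-∑ π′ ⟩
  ∑ (λ j → ⟦ inversion? π′ zero (suc j) ⟧) + ∑ (λ i → ⟦ inversion? π′ (suc i) zero ⟧ + ∑ (λ j → ⟦ inversion? π′ (suc i) (suc j) ⟧))
    ≡⟨ cong₂ _+_ first (∑-cong {n} λ i → cong₂ _+_ (⟦⟧-no (inversion? π′ (suc i) zero) λ ()) (∑-cong {n} (other i))) ⟩
  toℕ c + ∑ (λ i → ∑ (λ j → ⟦ inversion? π i j ⟧))     ≡⟨ cong (toℕ c +_) (trans (sym (inversions-∑ π)) (inversions-decode cs)) ⟩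
  toℕ c + sum (toList cs)                         ∎
  where
  open ≡-Reasoning
  π  = decode cs
  π′ = decode (c ∷ cs)
  first : ∑ (λ j → ⟦ inversion? π′ zero (suc j) ⟧) ≡ toℕ c
  first = trans (∑-cong {n} λ j → ⟦⟧-cong (inversion? π′ zero (suc j)) (val cs j <? toℕ c) (mk⇔
      (λ (_ , p) → bump-low⁻ (subst (_< toℕ c) (val-suc c cs j) p))
      (λ p → z<s , subst (_< toℕ c) (sym (trans (val-suc c cs j) (bump-low p))) p)))
    -- Reindexing by π turns positions that hold a value below `c` into values below `c`.
    (trans (sym (sum-permute (λ v → ⟦ toℕ v <? toℕ c ⟧) π)) (∑-below c))
  other : ∀ i j → ⟦ inversion? π′ (suc i) (suc j) ⟧ ≡ ⟦ inversion? π i j ⟧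
  other i j = ⟦⟧-cong (inversion? π′ (suc i) (suc j)) (inversion? π i j) (mk⇔
    (λ (p , q) → s<s⁻¹ p , bump-cancel (toℕ c) (subst (_< _) (val-suc c cs j) (subst (_ <_) (val-suc c cs i) q)))
    (λ (p , q) → s<s p , subst (_< _) (sym (val-suc c cs j)) (subst (_ <_) (sym (val-suc c cs i)) (bump-mono (toℕ c) q))))

inversions-cong : ∀ {n} (π ρ : Permutation′ n) → π Perm.≈ ρ → inversions π ≡ inversions ρ
inversions-cong {n} π ρ p = trans (inversions-∑ π) (trans
  (∑-cong {n} λ i → ∑-cong {n} λ j → ⟦⟧-cong (inversion? π i j) (inversion? ρ i j) (mk⇔
    (λ (q , r) → q , subst₂ Fin._<_ (p j) (p i) r)
    (λ (q , r) → q , subst₂ Fin._<_ (sym (p j)) (sym (p i)) r)))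
  (sym (inversions-∑ ρ)))

-- Pattern avoidance in terms of codes

Word : ℕ → Set
Word n = Fin n → ℕ

AvoidsW : ∀ {n} → Word n → Set
AvoidsW w = ∀ {i j k l} → i Fin.< j → j Fin.< k → k Fin.< l →
  ¬ (w i < w k × w k < w j × w j < w l) × ¬ (w i < w l × w l < w k × w k < w j)

quad : ∀ {A : Set} → A → A → A → A → Fin 4 → A
quad x y z w 0F = x
quad x y z w 1F = y
quad x y z w 2F = z
quad x y z w 3F = w

quad-< : ∀ {x y z w} → x < y → y < z → z < w → ∀ a b → a Fin.< b → quad x y z w a < quad x y z w b
quad-< p q r 0F 1F _ = p
quad-< p q r 0F 2F _ = <-trans p q
quad-< p q r 0F 3F _ = <-trans p (<-trans q r)
quad-< p q r 1F 2F _ = q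
quad-< p q r 1F 3F _ = <-trans q r
quad-< p q r 2F 3F _ = r
quad-< p q r 1F 1F (s≤s ())
quad-< p q r 2F 1F (s≤s ())
quad-< p q r 2F 2F (s≤s (s≤s ()))
quad-< p q r 3F 1F (s≤s ())
quad-< p q r 3F 2F (s≤s (s≤s ()))
quad-< p q r 3F 3F (s≤s (s≤s (s≤s ())))

<-reflecting : ∀ {n} {h : Word n} → (∀ a b → a Fin.< b → h a < h b) → ∀ a b → h a < h b → a Fin.< b
<-reflecting mono a b p with Fin.<-cmp a b
... | tri< a<b _ _  = a<b
... | tri≈ _ refl _ = contradiction p (<-irrefl refl)
... | tri> _ _ b<a  = contradiction p (<-asym (mono b a b<a))

-- An occurrence of q is given by its positions x and by its values y in
-- increasing order.
contains : ∀ {n} {π : Permutation′ n} {q : Permutation′ 4} {x : Fin 4 → Fin n} {y : Fin 4 → ℕ} →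
           (∀ a b → a Fin.< b → toℕ (x a) < toℕ (x b)) → (∀ a b → a Fin.< b → y a < y b) →
           (∀ a → toℕ (π ⟨$⟩ʳ x a) ≡ y (q ⟨$⟩ʳ a)) → Contains π (4 , q)
contains {x = x} x-mono y-mono p = x , x-mono , λ a b → mk⇔
  (λ r → subst₂ _<_ (sym (p a)) (sym (p b)) (y-mono _ _ r))
  (λ r → <-reflecting y-mono _ _ (subst₂ _<_ (p a) (p b) r))

toℕ-quad : ∀ {n} (i j k l : Fin n) a → quad (toℕ i) (toℕ j) (toℕ k) (toℕ l) a ≡ toℕ (quad i j k l a)
toℕ-quad i j k l 0F = refl
toℕ-quad i j k l 1F = refl
toℕ-quad i j k l 2F = refl
toℕ-quad i j k l 3F = refl

avoidsW⁺ : ∀ {n} {π : Permutation′ n} → All (Avoids π) (p1324 ∷ p1432 ∷ []) → AvoidsW (λ i → toℕ (π ⟨$⟩ʳ i))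
avoidsW⁺ {π = π} (av₁ ∷ av₂ ∷ []) {i} {j} {k} {l} i<j j<k k<l =
  (λ (p , q , r) → av₁ (contains {π = π} {q = proj₂ p1324} x-mono (quad-< p q r) λ where 0F → refl; 1F → refl; 2F → refl; 3F → refl)) ,
  (λ (p , q , r) → av₂ (contains {π = π} {q = proj₂ p1432} x-mono (quad-< p q r) λ where 0F → refl; 1F → refl; 2F → refl; 3F → refl))
  where
  x-mono : ∀ a b → a Fin.< b → toℕ (quad i j k l a) < toℕ (quad i j k l b)
  x-mono a b p = subst₂ _<_ (toℕ-quad i j k l a) (toℕ-quad i j k l b) (quad-< i<j j<k k<l a b p)

avoidsW⁻ : ∀ {n} {π : Permutation′ n} → AvoidsW (λ i → toℕ (π ⟨$⟩ʳ i)) → All (Avoids π) (p1324 ∷ p1432 ∷ [])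
avoidsW⁻ av =
  (λ (f , mono , iff) → proj₁ (av (mono 0F 1F 0<1) (mono 1F 2F 1<2) (mono 2F 3F 2<3))
    (Equivalence.to (iff 0F 2F) 0<1 , Equivalence.to (iff 2F 1F) 1<2 , Equivalence.to (iff 1F 3F) 2<3)) ∷
  (λ (f , mono , iff) → proj₂ (av (mono 0F 1F 0<1) (mono 1F 2F 1<2) (mono 2F 3F 2<3))
    (Equivalence.to (iff 0F 3F) 0<1 , Equivalence.to (iff 3F 2F) 1<2 , Equivalence.to (iff 2F 1F) 2<3)) ∷ []
  where
  0<1 : 0 < 1
  0<1 = z<s
  1<2 : 1 < 2
  1<2 = s<s z<s
  2<3 : 2 < 3
  2<3 = s<s (s<s z<s)

-- The entries of value at least t avoid 213 and 321.
AvoidsAbove : ∀ {n} → ℕ → Word n → Set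
AvoidsAbove t w = ∀ {i j k} → i Fin.< j → j Fin.< k →
  ¬ (t ≤ w j × w j < w i × w i < w k) × ¬ (t ≤ w k × w k < w j × w j < w i)

-- What a first entry c ≥ t adds to AvoidsAbove t.
Follows : ∀ {n} → ℕ → ℕ → Word n → Set
Follows t c w = ∀ {i j} → i Fin.< j → t ≤ w i → w i < c → t ≤ w j → w i < w j × w j < c

above⇒avoids : ∀ {n} {w : Word n} → AvoidsAbove 0 w → AvoidsW w
above⇒avoids s i<j j<k k<l =
  (λ (p , q , r) → proj₁ (s j<k k<l) (z≤n , q , r)) ,
  (λ (p , q , r) → proj₂ (s j<k k<l) (z≤n , q , r))

above-antitone : ∀ {n t u} {w : Word n} → t ≤ u → AvoidsAbove t w → AvoidsAbove u w
above-antitone t≤u s i<j j<k =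
  (λ (p , q) → proj₁ (s i<j j<k) (≤-trans t≤u p , q)) ,
  (λ (p , q) → proj₂ (s i<j j<k) (≤-trans t≤u p , q))

follows-vacuous : ∀ {n t c} {w : Word n} → c ≤ t → Follows t c w
follows-vacuous c≤t _ p q _ = contradiction (<-≤-trans q c≤t) (≤⇒≯ p)

-- Prepending one entry to a code

bump-≤ : ∀ {c t v} → t ≤ c → t ≤ v → t ≤ bump c v
bump-≤ {c} {t} {v} t≤c t≤v with v <? c
... | yes p = subst (t ≤_) (sym (bump-low p)) t≤v
... | no p  = subst (t ≤_) (sym (bump-high (≮⇒≥ p))) (m≤n⇒m≤1+n t≤v)

bump-≤⁻ : ∀ {c t v} → t ≤ c → t ≤ bump c v → t ≤ v
bump-≤⁻ {c} {t} {v} t≤c p with v <? c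
... | yes q = subst (t ≤_) (bump-low q) p
... | no q  = ≤-trans t≤c (≮⇒≥ q)

bump-suc≤ : ∀ {c t v} → c ≤ t → t ≤ v → suc t ≤ bump c v
bump-suc≤ {t = t} c≤t t≤v = subst (suc t ≤_) (sym (bump-high (≤-trans c≤t t≤v))) (s≤s t≤v)

bump-suc≤⁻ : ∀ {c t v} → c ≤ t → suc t ≤ bump c v → t ≤ v
bump-suc≤⁻ {c} {t} {v} c≤t p with v <? c
... | yes q = contradiction (subst (suc t ≤_) (bump-low q) p) (≤⇒≯ (<⇒≤ (<-≤-trans q c≤t)))
... | no q  = s≤s⁻¹ (subst (suc t ≤_) (bump-high (≮⇒≥ q)) p)

bump-above : ∀ {c v} → c ≤ v → c < bump c v
bump-above {c} c≤v = bump-suc≤ ≤-refl c≤v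

module _ {n} (c : Fin (suc n)) (cs : Code n) where
  private
    w  = val cs
    w′ = val (c ∷ cs)
    d  = toℕ c

    up : ∀ {P : ℕ → Set} i → P (bump d (w i)) → P (w′ (suc i))
    up {P} i = subst P (sym (val-suc c cs i))

    dn : ∀ {P : ℕ → Set} i → P (w′ (suc i)) → P (bump d (w i))
    dn {P} i = subst P (val-suc c cs i)

    up-< : ∀ {i j} → w i < w j → w′ (suc i) < w′ (suc j)
    up-< {i} {j} p = subst₂ _<_ (sym (val-suc c cs i)) (sym (val-suc c cs j)) (bump-mono d p)

    dn-< : ∀ {i j} → w′ (suc i) < w′ (suc j) → w i < w j
    dn-< {i} {j} p = bump-cancel d (subst₂ _<_ (val-suc c cs i) (val-suc c cs j) p)

  avoids-tail : AvoidsW w′ → AvoidsW w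
  avoids-tail av i<j j<k k<l =
    (λ (p , q , r) → proj₁ (av (s<s i<j) (s<s j<k) (s<s k<l)) (up-< p , up-< q , up-< r)) ,
    (λ (p , q , r) → proj₂ (av (s<s i<j) (s<s j<k) (s<s k<l)) (up-< p , up-< q , up-< r))

  -- The first entry takes the role of 1 in either pattern; later entries above it come from the
  -- values at least `d` before relabelling.
  avoids-head : AvoidsW w′ → AvoidsAbove d w
  avoids-head av {i} {j} {k} i<j j<k =
    (λ (p , q , r) → proj₁ (av z<s (s<s i<j) (s<s j<k)) (up {d <_} j (bump-above p) , up-< q , up-< r)) ,
    (λ (p , q , r) → proj₂ (av z<s (s<s i<j) (s<s j<k)) (up {d <_} k (bump-above p) , up-< q , up-< r))

  avoids-∷ : AvoidsAbove d w → AvoidsW w → AvoidsW w′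
  avoids-∷ s av {zero} {suc j} {suc k} {suc l} i<j j<k k<l =
    (λ (p , q , r) → proj₁ (s (s<s⁻¹ j<k) (s<s⁻¹ k<l)) (bump-high⁻ (dn {d <_} k p) , dn-< q , dn-< r)) ,
    (λ (p , q , r) → proj₂ (s (s<s⁻¹ j<k) (s<s⁻¹ k<l)) (bump-high⁻ (dn {d <_} l p) , dn-< q , dn-< r))
  avoids-∷ s av {suc i} {suc j} {suc k} {suc l} i<j j<k k<l =
    (λ (p , q , r) → proj₁ (av (s<s⁻¹ i<j) (s<s⁻¹ j<k) (s<s⁻¹ k<l)) (dn-< p , dn-< q , dn-< r)) ,
    (λ (p , q , r) → proj₂ (av (s<s⁻¹ i<j) (s<s⁻¹ j<k) (s<s⁻¹ k<l)) (dn-< p , dn-< q , dn-< r))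

  above-tail : ∀ {t} → t ≤ d → AvoidsAbove t w′ → AvoidsAbove t w
  above-tail {t} t≤d s {i} {j} {k} i<j j<k =
    (λ (p , q , r) → proj₁ (s (s<s i<j) (s<s j<k)) (up {t ≤_} j (bump-≤ t≤d p) , up-< q , up-< r)) ,
    (λ (p , q , r) → proj₂ (s (s<s i<j) (s<s j<k)) (up {t ≤_} k (bump-≤ t≤d p) , up-< q , up-< r))

  -- With the first entry as the 2 of a 213, no later `w j` may reach `d`; with it as the 3 of a
  -- 321, no descent may follow.
  above-head : ∀ {t} → t ≤ d → AvoidsAbove t w′ → Follows t d w
  above-head {t} t≤d s {i} {j} i<j t≤wi wi<d t≤wj = wi<wj , wj<d
    where
    wj<d : w j < d
    wj<d = ≰⇒> λ d≤wj → proj₁ (s z<s (s<s i<j))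
      (up {t ≤_} i (bump-≤ t≤d t≤wi) , up {_< d} i (subst (_< d) (sym (bump-low wi<d)) wi<d) , up {d <_} j (bump-above d≤wj))
    wi<wj : w i < w j
    wi<wj with <-cmp (w i) (w j)
    ... | tri< p _ _ = p
    ... | tri≈ _ p _ = contradiction (Perm-injective p) (Fin.<⇒≢ i<j)
      where
      Perm-injective : w i ≡ w j → i ≡ j
      Perm-injective p = trans (sym (Perm.inverseˡ (decode cs)))
        (trans (cong (decode cs ⟨$⟩ˡ_) (Fin.toℕ-injective p)) (Perm.inverseˡ (decode cs)))
    ... | tri> _ _ p = contradiction
      (up {t ≤_} j (bump-≤ t≤d t≤wj) , up-< p , up {_< d} i (subst (_< d) (sym (bump-low wi<d)) wi<d))
      (proj₂ (s z<s (s<s i<j)))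

  above-∷-high : ∀ {t} → AvoidsAbove t w → Follows t d w → t ≤ d → AvoidsAbove t w′
  above-∷-high {t} s f t≤d {zero} {suc j} {suc k} i<j j<k =
    (λ (p , q , r) → let wj<d = bump-low⁻ (dn {_< d} j q) in
      contradiction (bump-high⁻ (dn {d <_} k r)) (<⇒≱ (proj₂ (f (s<s⁻¹ j<k) (bump-≤⁻ t≤d (dn {t ≤_} j p)) wj<d
        (≤-trans t≤d (bump-high⁻ (dn {d <_} k r))))))) ,
    (λ (p , q , r) → let wk<wj = dn-< q ; t≤wk = bump-≤⁻ t≤d (dn {t ≤_} k p) in
      <-asym wk<wj (proj₁ (f (s<s⁻¹ j<k) (≤-trans t≤wk (<⇒≤ wk<wj)) (bump-low⁻ (dn {_< d} j r)) t≤wk)))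
  above-∷-high {t} s f t≤d {suc i} {suc j} {suc k} i<j j<k =
    (λ (p , q , r) → proj₁ (s (s<s⁻¹ i<j) (s<s⁻¹ j<k)) (bump-≤⁻ t≤d (dn {t ≤_} j p) , dn-< q , dn-< r)) ,
    (λ (p , q , r) → proj₂ (s (s<s⁻¹ i<j) (s<s⁻¹ j<k)) (bump-≤⁻ t≤d (dn {t ≤_} k p) , dn-< q , dn-< r))

  -- The first entry lies under the new threshold and joins no forbidden triple, while relabelling
  -- raises exactly the values from `t` on to values from `suc t` on.
  above-∷-low : ∀ {t} → d ≤ t → AvoidsAbove t w → AvoidsAbove (suc t) w′
  above-∷-low {t} d≤t s {zero} {suc j} {suc k} i<j j<k =
    (λ (p , q , r) → <-irrefl refl (<-≤-trans (<-trans p q) d≤t)) ,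
    (λ (p , q , r) → <-irrefl refl (<-≤-trans (<-trans p (<-trans q r)) d≤t))
  above-∷-low {t} d≤t s {suc i} {suc j} {suc k} i<j j<k =
    (λ (p , q , r) → proj₁ (s (s<s⁻¹ i<j) (s<s⁻¹ j<k)) (bump-suc≤⁻ d≤t (dn {suc t ≤_} j p) , dn-< q , dn-< r)) ,
    (λ (p , q , r) → proj₂ (s (s<s⁻¹ i<j) (s<s⁻¹ j<k)) (bump-suc≤⁻ d≤t (dn {suc t ≤_} k p) , dn-< q , dn-< r))

  follows-low : ∀ {t u} → d ≤ t → t ≤ u → Follows (suc t) (suc u) w′ → Follows t u w
  follows-low {t} {u} d≤t t≤u f {i} {j} i<j p q r =
    let p′ , q′ = f (s<s i<j) (up {suc t ≤_} i (bump-suc≤ d≤t p))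
                    (up {_< suc u} i (subst (_< suc u) (sym (bump-high (≤-trans d≤t p))) (s<s q)))
                    (up {suc t ≤_} j (bump-suc≤ d≤t r))
    in dn-< p′ , s<s⁻¹ (subst (_< suc u) (bump-high (≤-trans d≤t r)) (dn {_< suc u} j q′))

  follows-high : ∀ {t u} → t ≤ d → u ≤ d → Follows t u w′ → Follows t u w
  follows-high {t} {u} t≤d u≤d f {i} {j} i<j p q r =
    let p′ , q′ = f (s<s i<j) (up {t ≤_} i (bump-≤ t≤d p))
                    (up {_< u} i (subst (_< u) (sym (bump-low (<-≤-trans q u≤d))) q))
                    (up {t ≤_} j (bump-≤ t≤d r))
    in dn-< p′ , ≰⇒> λ u≤wj → <⇒≱ (dn {_< u} j q′) (bump-≤ u≤d u≤wj)

  -- The first entry itself qualifies as `w i` in `Follows`, so no later value is `u`. But `u`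
  -- occurs as a value as soon as `u ≤ n`.
  follows-mid-> : ∀ {t u} → t ≤ d → d < u → Follows t u w′ → n < u
  follows-mid-> {t} {u} t≤d d<u f with n <? u
  ... | yes p = p
  ... | no p  = contradiction (proj₂ (f {zero} {suc j} z<s t≤d d<u (≤-trans t≤d (≤-trans (<⇒≤ d<u) (≤-reflexive (sym w′j≡u))))))
                  (<-irrefl w′j≡u)
    where
    -- Since `d < u`, relabelling sends the value `pred u` to `u`; its position is found with the
    -- inverse permutation.
    u′ = pred u
    u≡ : suc u′ ≡ u
    u≡ = suc-pred u {{>-nonZero (≤-<-trans z≤n d<u)}}
    u′<n : u′ < n
    u′<n = subst (_≤ n) (sym u≡) (≮⇒≥ p)
    j = decode cs ⟨$⟩ˡ fromℕ< u′<n
    wj≡ : w j ≡ u′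
    wj≡ = trans (cong toℕ (Perm.inverseʳ (decode cs))) (Fin.toℕ-fromℕ< u′<n)
    w′j≡u : w′ (suc j) ≡ u
    w′j≡u = trans (val-suc c cs j) (trans (bump-high (subst (d ≤_) (sym wj≡) (s≤s⁻¹ (subst (d <_) (sym u≡) d<u)))) (trans (cong suc wj≡) u≡))

  -- `Follows` places the first entry below all later values, and 0 has to occur somewhere.
  follows-mid-≡0 : ∀ {u} → d < u → Follows 0 u w′ → d ≡ 0
  follows-mid-≡0 {u} d<u f with d ≟ 0
  ... | yes p = p
  ... | no p  = contradiction (proj₁ (f {zero} {suc j} z<s z≤n d<u z≤n)) (≤⇒≯ (subst (_≤ d) (sym w′j≡0) z≤n))
    where
    0<d : 0 < d
    0<d = n≢0⇒n>0 p
    0<n : 0 < n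
    0<n = <-≤-trans 0<d (s≤s⁻¹ (Fin.toℕ<n c))
    j = decode cs ⟨$⟩ˡ fromℕ< 0<n
    wj≡0 : w j ≡ 0
    wj≡0 = trans (cong toℕ (Perm.inverseʳ (decode cs))) (Fin.toℕ-fromℕ< 0<n)
    w′j≡0 : w′ (suc j) ≡ 0
    w′j≡0 = trans (val-suc c cs j) (trans (bump-low (subst (_< d) (sym wj≡0) 0<d)) wj≡0)

  -- The removed value lies below the bound, so the bound drops by one with it.
  follows-mid-tail : ∀ {t u} → t ≤ d → d ≤ u → Follows t (suc u) w′ → Follows t u w
  follows-mid-tail {t} {u} t≤d d≤u f {i} {j} i<j p q r =
    let p′ , q′ = f (s<s i<j) (up {t ≤_} i (bump-≤ t≤d p)) (up {_< suc u} i (bound i q)) (up {t ≤_} j (bump-≤ t≤d r))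
    in dn-< p′ , ≰⇒> λ u≤wj → <⇒≱ (dn {_< suc u} j q′) (bump-suc≤ d≤u u≤wj)
    where
    bound : ∀ i → w i < u → bump d (w i) < suc u
    bound i q with w i <? d
    ... | yes p = subst (_< suc u) (sym (bump-low p)) (m≤n⇒m≤1+n q)
    ... | no p  = subst (_< suc u) (sym (bump-high (≮⇒≥ p))) (s<s q)

  follows-∷ : ∀ {u} → u ≤ d → Follows 0 u w → Follows 0 u w′
  follows-∷ u≤d f {zero}  {suc j} i<j p q r = contradiction q (≤⇒≯ u≤d)
  follows-∷ {u} u≤d f {suc i} {suc j} i<j p q r =
    let wi<u = below i q ; p′ , q′ = f (s<s⁻¹ i<j) z≤n wi<u z≤n
    in up-< p′ , up {_< u} j (subst (_< u) (sym (bump-low (<-≤-trans q′ u≤d))) q′)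
    where
    below : ∀ i → w′ (suc i) < u → w i < u
    below i q = ≰⇒> λ u≤wi → <⇒≱ (dn {_< u} i q) (bump-≤ u≤d u≤wi)

-- The shape of avoiding codes

hd : List ℕ → ℕ
hd []      = 0
hd (x ∷ _) = x

-- Codes of the permutations avoiding 213 and 321.
data Tail : List ℕ → Set where
  []   : Tail []
  zero : ∀ {xs} → Tail xs → Tail (0 ∷ xs)
  box  : ∀ {a} b → 0 < a → Tail (a ∷ replicate b a ++ replicate a 0)

-- The first 0 closes the partition: it is the smallest value, so everything after it must avoid 213
-- and 321.
data Good : List ℕ → Set where
  zero : ∀ {xs} → Tail xs → Good (0 ∷ xs)
  part : ∀ {x xs} → 0 < x → hd xs ≤ x → Good xs → Good (x ∷ xs)

val-zeros : ∀ {n m} (cs : Code n) → toList cs ≡ replicate m 0 → ∀ i → val cs i ≡ toℕ i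
val-zeros {m = suc m} (zero ∷ cs) eq zero    = refl
val-zeros {m = suc m} (zero ∷ cs) eq (suc i) = cong suc (val-zeros {m = m} cs (List.∷-injectiveʳ eq) i)

-- The permutation is a, ..., a + b - 1, 0, ..., a - 1. `Follows 0 a` is carried along because it is
-- what prepending another `a` demands.
box⇒follows : ∀ {n} b {a} (cs : Code n) → toList cs ≡ replicate b a ++ replicate a 0 →
              AvoidsAbove 0 (val cs) × Follows 0 a (val cs)
box⇒follows {n} zero {a} cs eq = above , follows
  where
  mono : ∀ {i j} → i Fin.< j → val cs i < val cs j
  mono {i} {j} p = subst₂ _<_ (sym (val-zeros {m = a} cs eq i)) (sym (val-zeros {m = a} cs eq j)) p
  n≡a : n ≡ a
  n≡a = trans (sym (length-toList cs)) (trans (cong length eq) (List.length-replicate a))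
  above : AvoidsAbove 0 (val cs)
  above i<j j<k = (λ (_ , p , _) → <-asym p (mono i<j)) , (λ (_ , p , _) → <-asym p (mono j<k))
  follows : Follows 0 a (val cs)
  follows {i} {j} i<j _ _ _ = mono i<j , subst₂ _<_ (sym (val-zeros {m = a} cs eq j)) n≡a (Fin.toℕ<n j)
box⇒follows (suc b) (c ∷ cs) eq with List.∷-injective eq
... | c≡a , eq′ with box⇒follows b cs eq′
...   | above , follows =
  above-∷-high c cs above (subst (λ a → Follows 0 a (val cs)) (sym c≡a) follows) z≤n ,
  follows-∷ c cs (≤-reflexive (sym c≡a)) follows

tail⇒above : ∀ {n} (cs : Code n) → Tail (toList cs) → AvoidsAbove 0 (val cs)
tail⇒above cs = go cs refl
  where
  go : ∀ {n xs} (cs : Code n) → toList cs ≡ xs → Tail xs → AvoidsAbove 0 (val cs)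
  go []          eq []              {i = ()}
  go (zero ∷ cs) eq (zero t)        = above-∷-high zero cs (go cs (List.∷-injectiveʳ eq) t) (follows-vacuous ≤-refl) z≤n
  go (c ∷ cs)    eq (box {a} b 0<a) = proj₁ (box⇒follows (suc b) {a} (c ∷ cs) eq)

-- A first part equal to `t` makes `Follows t t` vacuous. A smaller one lies under the threshold and
-- lowers it by one for the rest, which still leaves it at least the next part because the parts
-- weakly decrease.
good⇒above : ∀ {n t} (cs : Code n) → Good (toList cs) → hd (toList cs) ≤ t → AvoidsAbove t (val cs)
good⇒above (zero ∷ cs) (zero t)     p = above-antitone z≤n (tail⇒above (zero ∷ cs) (zero t))
good⇒above {t = t} (c ∷ cs) (part q r g) p with toℕ c ≟ t
... | yes refl = above-∷-high c cs (good⇒above cs g r) (follows-vacuous ≤-refl) ≤-refl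
... | no c≢t   with t | ≤∧≢⇒< p c≢t
...   | suc t | s≤s c≤t = above-∷-low c cs c≤t (good⇒above cs g (≤-trans r c≤t))

good⇒avoids : ∀ {n} (cs : Code n) → Good (toList cs) → AvoidsW (val cs)
good⇒avoids (zero ∷ cs) (zero t)     = above⇒avoids (tail⇒above (zero ∷ cs) (zero t))
good⇒avoids (c ∷ cs)    (part p q g) = avoids-∷ c cs (good⇒above cs g q) (good⇒avoids cs g)

follows⇒zeros : ∀ {n} (cs : Code n) → Follows 0 n (val cs) → toList cs ≡ replicate n 0
follows⇒zeros []       f = refl
follows⇒zeros (c ∷ cs) f = cong₂ _∷_ (follows-mid-≡0 c cs (Fin.toℕ<n c) f)
  (follows⇒zeros cs (follows-mid-tail c cs z≤n (s≤s⁻¹ (Fin.toℕ<n c)) f))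

-- Copies of `a` are at least `c` and can be stripped by `follows-high`. The first 0 then lies below
-- `c`, so `follows-mid->` bounds the number `a` of zeros by `c`.
box-follows-≤ : ∀ {n} b {a c} (cs : Code n) → toList cs ≡ replicate b a ++ replicate a 0 →
                Follows 0 c (val cs) → 0 < c → c ≤ a → a ≤ c
box-follows-≤ zero    {zero}  cs       eq f 0<c c≤a = z≤n
box-follows-≤ zero    {suc a} {c} (zero ∷ cs) eq f 0<c c≤a =
  subst (_≤ c) (trans (sym (length-toList (zero ∷ cs))) (trans (cong length eq) (List.length-replicate (suc a))))
    (follows-mid-> zero cs z≤n 0<c f)
box-follows-≤ (suc b) {a} {c} (d ∷ cs) eq f 0<c c≤a with List.∷-injective eq
... | d≡a , eq′ = box-follows-≤ b cs eq′ (follows-high d cs z≤n (subst (c ≤_) (sym d≡a) c≤a) f) 0<c c≤a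

-- If the next entry `d` is below `c`, all later values are, so `c` equals the length of the rest
-- and the rest is increasing. Otherwise the rest is by induction a block of `d`s, and
-- `box-follows-≤` excludes `d > c`.
above⇒box : ∀ {n} c (cs : Code n) → 0 < toℕ c → AvoidsAbove 0 (val (c ∷ cs)) →
            ∃ λ b → toList cs ≡ replicate b (toℕ c) ++ replicate (toℕ c) 0
above⇒box zero [] ()
above⇒box {suc n} c (d ∷ cs) 0<c s with above-head c (d ∷ cs) z≤n s | toℕ d <? toℕ c
... | f | yes d<c = 0 , subst (λ m → toList (d ∷ cs) ≡ replicate m 0) n≡c
                          (follows⇒zeros (d ∷ cs) (subst (λ m → Follows 0 m (val (d ∷ cs))) (sym n≡c) f))
  where
  n≡c : suc n ≡ toℕ c
  n≡c = ≤-antisym (follows-mid-> d cs z≤n d<c f) (s≤s⁻¹ (Fin.toℕ<n c))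
... | f | no d≮c with c≤d ← ≮⇒≥ d≮c with above⇒box d cs (<-≤-trans 0<c c≤d) (above-tail c (d ∷ cs) z≤n s)
...   | b , eq with ≤-antisym c≤d (box-follows-≤ b cs eq (follows-high d cs z≤n c≤d f) 0<c c≤d)
...     | c≡d = suc b , cong₂ _∷_ (sym c≡d) (subst (λ x → toList cs ≡ replicate b x ++ replicate x 0) (sym c≡d) eq)

above⇒tail : ∀ {n} (cs : Code n) → AvoidsAbove 0 (val cs) → Tail (toList cs)
above⇒tail []             s = []
above⇒tail (zero ∷ cs)    s = zero (above⇒tail cs (above-tail zero cs z≤n s))
above⇒tail (c@(suc _) ∷ cs) s with above⇒box c cs z<s s
... | b , eq = subst (λ xs → Tail (toℕ c ∷ xs)) (sym eq) (box b z<s)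

-- An entry in [t, d) forces all values below d, but d < n since the sum is small.
¬follows : ∀ {n t d} (cs : Code n) → t < d → d + sum (toList cs) < n → ¬ Follows t d (val cs)
¬follows {suc n} {t} {d} (c ∷ cs) t<d q f with toℕ c <? t
¬follows {suc n} {suc t} {suc d} (c ∷ cs) t<d q f | yes c<t =
  ¬follows cs (s<s⁻¹ t<d) (≤-trans (s≤s (+-monoʳ-≤ d (m≤n+m _ (toℕ c)))) (s≤s⁻¹ q))
    (follows-low c cs (s≤s⁻¹ c<t) (<⇒≤ (s<s⁻¹ t<d)) f)
... | no c≮t with toℕ c <? d
...   | yes c<d = <⇒≱ (follows-mid-> c cs (≮⇒≥ c≮t) c<d f) (≤-trans (m≤m+n d _) (s≤s⁻¹ q))
...   | no c≮d  = ¬follows cs t<d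
  (s≤s⁻¹ (≤-trans (s≤s (subst (_≤ d + (toℕ c + sum (toList cs))) (+-suc d _)
                  (+-monoʳ-≤ d (+-monoˡ-≤ (sum (toList cs)) (<-≤-trans (≤-<-trans z≤n t<d) (≮⇒≥ c≮d)))))) q))
  (follows-high c cs (≮⇒≥ c≮t) (≮⇒≥ c≮d) f)

avoids⇒good : ∀ {n} (cs : Code n) → sum (toList cs) + 2 ≤ n → AvoidsW (val cs) → Good (toList cs)
avoids⇒good [] p = contradiction p λ ()
avoids⇒good (zero ∷ cs) p av = zero (above⇒tail cs (avoids-head zero cs av))
avoids⇒good {suc n} (c@(suc c′) ∷ cs) p av =
  part z<s (head≤ cs few (avoids-head c cs av)) (avoids⇒good cs (≤-trans (+-monoˡ-≤ 2 (m≤n+m _ (toℕ c′))) (s≤s⁻¹ p)) (avoids-tail c cs av))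
  where
  few : sum (toList cs) + 2 ≤ n
  few = ≤-trans (+-monoˡ-≤ 2 (m≤n+m _ (toℕ c′))) (s≤s⁻¹ p)
  head≤ : ∀ {n t} (cs : Code n) → sum (toList cs) + 2 ≤ n → AvoidsAbove t (val cs) → hd (toList cs) ≤ t
  head≤ []       _ s = z≤n
  -- Of the 2, one pays for the entry `d` and the other gives the strict inequality that `¬follows`
  -- asks of `ds`.
  head≤ {suc n} {t} (d ∷ ds) p s = ≮⇒≥ λ t<d →
    ¬follows ds t<d (s≤s⁻¹ (subst (_≤ suc n) (+-comm (toℕ d + sum (toList ds)) 2) p)) (above-head d ds (<⇒≤ t<d) s)

-- Good codes as a partition, zeros and a box

tail⇒valid : ∀ {xs} → Tail xs → Valid xs
tail⇒valid []       = []
tail⇒valid (zero t) = z≤n ∷ tail⇒valid t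
tail⇒valid (box {a} b _) = go (suc b)
  where
  zeros : ∀ m → Valid (replicate m 0)
  zeros zero    = []
  zeros (suc m) = z≤n ∷ zeros m
  go : ∀ b → Valid (replicate b a ++ replicate a 0)
  go zero    = zeros a
  go (suc b) = subst (a ≤_) (sym (trans (List.length-++ (replicate b a))
                 (cong (length (replicate b a) +_) (List.length-replicate a)))) (m≤n+m a _) ∷ go b

-- A part is at most the whole sum, hence at most the number of entries after it. In the tail, each
-- copy of `a` has `a` zeros after it.
good⇒valid : ∀ {xs} → Good xs → sum xs < length xs → Valid xs
good⇒valid (zero t)     p = z≤n ∷ tail⇒valid t
good⇒valid {suc x ∷ xs} (part _ _ g) p =
  ≤-trans (m≤m+n (suc x) _) (s≤s⁻¹ p) ∷ good⇒valid g (≤-trans (s≤s (m≤n+m _ x)) (s≤s⁻¹ p))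

-- The absent box is recorded only as 0 × 0; other boxes with a side 0 would represent it repeatedly
-- and spoil injectivity.
data Box : ℕ → ℕ → Set where
  none : Box 0 0
  some : ∀ {a b} → 0 < a → 0 < b → Box a b

block : ℕ → ℕ → List ℕ
block a b = replicate b a ++ replicate a 0

-- The `0` after `ps` is mandatory: it separates the partition from the block even when `z` is 0.
layout : List ℕ → ℕ → ℕ → ℕ → List ℕ
layout ps z a b = ps ++ 0 ∷ replicate z 0 ++ block a b

zeros-block⇒tail : ∀ {a b} z → Box a b → Tail (replicate z 0 ++ block a b)
zeros-block⇒tail (suc z) x    = zero (zeros-block⇒tail z x)
zeros-block⇒tail zero    none = []
zeros-block⇒tail {b = suc b} zero (some 0<a _) = box b 0<a

tail⇒zeros-block : ∀ {xs} → Tail xs → ∃ λ z → ∃ λ a → ∃ λ b → Box a b × xs ≡ replicate z 0 ++ block a b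
tail⇒zeros-block []            = 0 , 0 , 0 , none , refl
tail⇒zeros-block (zero t)      = let z , a , b , x , eq = tail⇒zeros-block t in suc z , a , b , x , cong (0 ∷_) eq
tail⇒zeros-block (box {a} b p) = 0 , a , suc b , some p z<s , refl

linked-∷ : ∀ {x xs} → hd xs ≤ x → Linked _≥_ xs → Linked _≥_ (x ∷ xs)
linked-∷ {xs = []}    p l = [-]
linked-∷ {xs = _ ∷ _} p l = p ∷ l

linked-hd : ∀ {x xs} → Linked _≥_ (x ∷ xs) → hd xs ≤ x
linked-hd [-]     = z≤n
linked-hd (p ∷ _) = p

linked-tail : ∀ {x xs} → Linked _≥_ (x ∷ xs) → Linked _≥_ xs
linked-tail [-]     = []
linked-tail (_ ∷ l) = l

hd-++-0 : ∀ ps xs → hd (ps ++ 0 ∷ xs) ≡ hd ps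
hd-++-0 []      xs = refl
hd-++-0 (_ ∷ _) xs = refl

layout⇒good : ∀ {ps a b} z → IsPartition ps → Box a b → Good (layout ps z a b)
layout⇒good {[]}     z p x = zero (zeros-block⇒tail z x)
layout⇒good {p ∷ ps} z (l , 0<p ∷ pos) x =
  part 0<p (subst (_≤ p) (sym (hd-++-0 ps _)) (linked-hd l)) (layout⇒good z (linked-tail l , pos) x)

good⇒layout : ∀ {xs} → Good xs → ∃ λ ps → ∃ λ z → ∃ λ a → ∃ λ b →
              IsPartition ps × Box a b × xs ≡ layout ps z a b
good⇒layout (zero t) = let z , a , b , x , eq = tail⇒zeros-block t in
  [] , z , a , b , ([] , []) , x , cong (0 ∷_) eq
good⇒layout {y ∷ _} (part 0<y h g) with good⇒layout g
... | ps , z , a , b , (l , pos) , x , refl =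
  y ∷ ps , z , a , b , (linked-∷ (subst (_≤ y) (hd-++-0 ps _) h) l , 0<y ∷ pos) , x , refl

sum-replicate : ∀ m x → sum (replicate m x) ≡ m * x
sum-replicate zero    x = refl
sum-replicate (suc m) x = cong (x +_) (sum-replicate m x)

sum-layout : ∀ ps z a b → sum (layout ps z a b) ≡ sum ps + b * a
sum-layout ps z a b = begin
  sum (ps ++ 0 ∷ replicate z 0 ++ block a b)              ≡⟨ sum-++ ps _ ⟩
  sum ps + sum (replicate z 0 ++ block a b)               ≡⟨ cong (sum ps +_) (sum-++ (replicate z 0) _) ⟩
  sum ps + (sum (replicate z 0) + sum (block a b))        ≡⟨ cong₂ (λ u v → sum ps + (u + v)) (zeros z) (sum-++ (replicate b a) _) ⟩
  sum ps + (sum (replicate b a) + sum (replicate a 0))    ≡⟨ cong (sum ps +_) (cong₂ _+_ (sum-replicate b a) (zeros a)) ⟩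
  sum ps + (b * a + 0)                                    ≡⟨ cong (sum ps +_) (+-identityʳ _) ⟩
  sum ps + b * a                                          ∎
  where
  open ≡-Reasoning
  zeros : ∀ m → sum (replicate m 0) ≡ 0
  zeros m = trans (sum-replicate m 0) (*-zeroʳ m)

length-block : ∀ a b → length (block a b) ≡ b + a
length-block a b = trans (List.length-++ (replicate b a)) (cong₂ _+_ (List.length-replicate b) (List.length-replicate a))

length-layout : ∀ ps z a b → length (layout ps z a b) ≡ suc (length ps + (b + a)) + z
length-layout ps z a b = begin
  length (ps ++ 0 ∷ replicate z 0 ++ block a b)           ≡⟨ List.length-++ ps ⟩
  length ps + suc (length (replicate z 0 ++ block a b))   ≡⟨ cong (λ m → length ps + suc m) (List.length-++ (replicate z 0)) ⟩
  length ps + suc (length (replicate z 0) + length (block a b))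
    ≡⟨ cong₂ (λ u v → length ps + suc (u + v)) (List.length-replicate z) (length-block a b) ⟩
  length ps + suc (z + (b + a))                           ≡⟨ +-suc (length ps) _ ⟩
  suc (length ps + (z + (b + a)))                         ≡⟨ cong (λ m → suc (length ps + m)) (+-comm z _) ⟩
  suc (length ps + ((b + a) + z))                         ≡⟨ cong suc (sym (+-assoc (length ps) _ z)) ⟩
  suc (length ps + (b + a)) + z                           ∎
  where open ≡-Reasoning

length≤sum : ∀ {ps} → All (_> 0) ps → length ps ≤ sum ps
length≤sum []          = z≤n
length≤sum (p ∷ pos) = +-mono-≤ p (length≤sum pos)

-- For a genuine box this is (a - 1)(b - 1) ≥ 0.
box-size : ∀ {a b} → Box a b → b + a ≤ suc (b * a)
box-size none = z≤n
box-size {suc a} {suc b} (some _ _) = s≤s (≤-trans (≤-reflexive (+-comm b (suc a))) (s≤s (+-monoʳ-≤ a (m≤m*n b (suc a)))))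

layout-fits : ∀ {ps a b} → IsPartition ps → Box a b → suc (length ps + (b + a)) ≤ (sum ps + b * a) + 2
layout-fits {ps} {a} {b} (_ , pos) x = begin
  suc (length ps + (b + a))          ≤⟨ s≤s (+-mono-≤ (length≤sum pos) (box-size x)) ⟩
  suc (sum ps + suc (b * a))         ≡⟨ cong suc (+-suc (sum ps) _) ⟩
  2 + (sum ps + b * a)               ≡⟨ +-comm 2 _ ⟩
  (sum ps + b * a) + 2               ∎
  where open ≤-Reasoning

parts-injective : ∀ {ps qs xs ys} → All (_> 0) ps → All (_> 0) qs →
                  ps ++ 0 ∷ xs ≡ qs ++ 0 ∷ ys → ps ≡ qs × xs ≡ ys
parts-injective []          []          refl = refl , refl
parts-injective []          (() ∷ _)    refl
parts-injective (() ∷ _)    []          refl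
parts-injective (_ ∷ p)     (_ ∷ q)     eq with List.∷-injective eq
... | refl , eq′ with parts-injective p q eq′
...   | refl , eq″ = refl , eq″

zeros-block-injective : ∀ {a b c d} y z → Box a b → Box c d →
  replicate y 0 ++ block a b ≡ replicate z 0 ++ block c d → a ≡ c × b ≡ d
zeros-block-injective zero zero none none eq = refl , refl
zeros-block-injective zero zero none (some {b = suc _} _ _) ()
zeros-block-injective zero zero (some {b = suc _} _ _) none ()
zeros-block-injective {a} {b} {c} {d} zero zero (some {b = suc _} _ _) (some {b = suc _} _ _) eq with List.∷-injectiveˡ eq
-- The first entry gives `a`, and then the length gives `b`.
... | refl = refl , +-cancelʳ-≡ a b d (trans (sym (length-block a b)) (trans (cong length eq) (length-block a d)))
zeros-block-injective zero (suc z) none x ()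
zeros-block-injective zero (suc z) (some {b = suc _} 0<a _) x eq = contradiction (List.∷-injectiveˡ eq) (>⇒≢ 0<a)
zeros-block-injective (suc y) zero x none ()
zeros-block-injective (suc y) zero x (some {b = suc _} 0<c _) eq = contradiction (List.∷-injectiveˡ eq) (<⇒≢ 0<c)
zeros-block-injective (suc y) (suc z) x x′ eq = zeros-block-injective y z x x′ (List.∷-injectiveʳ eq)

layout-injective : ∀ {ps qs a b c d} y z → IsPartition ps → IsPartition qs → Box a b → Box c d →
  layout ps y a b ≡ layout qs z c d → ps ≡ qs × a ≡ c × b ≡ d
layout-injective y z (_ , p) (_ , q) x x′ eq with parts-injective p q eq
... | refl , eq′ = refl , zeros-block-injective y z x x′ eq′

-- Bijections

bijective⇒inverse : (S T : Setoid 0ℓ 0ℓ) → let module S = Setoid S ; module T = Setoid T in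
  (f : S.Carrier → T.Carrier) → (∀ {x y} → x S.≈ y → f x T.≈ f y) → (∀ {x y} → f x T.≈ f y → x S.≈ y) →
  (∀ y → ∃ λ x → f x T.≈ y) → Inverse S T
bijective⇒inverse S T f f-cong injective surjective = Bijection⇒Inverse record
  { to        = f
  ; cong      = f-cong
  ; bijective = injective ,
      strictlySurjective⇒surjective {≈₂ = Setoid._≈_ T} {≈₁ = Setoid._≈_ S} (Setoid.trans T) f-cong surjective
  }

lookup-injective : ∀ {A : Set} {xs : List A} → Unique xs → ∀ i j → lookup xs i ≡ lookup xs j → i ≡ j
lookup-injective (_ ∷ _)  zero    zero    _  = refl
lookup-injective (px ∷ _) zero    (suc j) eq = contradiction eq (All.lookup px (∈-lookup j))
lookup-injective (px ∷ _) (suc i) zero    eq = contradiction (sym eq) (All.lookup px (∈-lookup i))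
lookup-injective (_ ∷ u)  (suc i) (suc j) eq = cong suc (lookup-injective u i j eq)

enumeration⇒hasSize : ∀ {A : Set} {P : A → Set} (xs : List A) → Unique xs →
  (∀ {x} → x ∈ xs → P x) → (∀ {x} → P x → x ∈ xs) → HasSize (Subset (setoid A) P) (length xs)
enumeration⇒hasSize {A} {P} xs unique sound complete = Symmetry.inverse
  (bijective⇒inverse (setoid (Fin (length xs))) (Subset (setoid A) P)
    (λ i → lookup xs i , sound (∈-lookup i)) (cong (lookup xs)) (lookup-injective unique _ _)
    (λ (x , p) → index (complete p) , sym (lookup-index (complete p))))

-- ps and the box a × b are the two blocks of the code layout ps z a b.
Shapes : ℕ → Setoid 0ℓ 0ℓ
Shapes k = Subset (setoid (List ℕ × ℕ × ℕ)) λ (ps , a , b) → IsPartition ps × Box a b × sum ps + b * a ≡ k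

shapes↔Av : ∀ k n → n ≥ k + 2 → Inverse (Shapes k) (Av n k (p1324 ∷ p1432 ∷ []))
shapes↔Av k n k+2≤n = bijective⇒inverse (Shapes k) (Av n k (p1324 ∷ p1432 ∷ []))
  to
  (λ { {x} {y} refl → λ i → cong (λ cs → decode cs ⟨$⟩ʳ i)
    (toList-injective _ _ (trans (proj₂ (code x)) (sym (proj₂ (code y))))) })
  (λ {x} {y} → injective x y)
  surjective
  where
  Shape = Setoid.Carrier (Shapes k)

  padding : Shape → ℕ
  padding ((ps , a , b) , _) = n ∸ suc (length ps + (b + a))

  toLayout : Shape → List ℕ
  toLayout x@((ps , a , b) , _) = layout ps (padding x) a b

  sum≡ : ∀ x → sum (toLayout x) ≡ k
  sum≡ x@((ps , a , b) , _ , _ , size) = trans (sum-layout ps (padding x) a b) size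

  length≡ : ∀ x → length (toLayout x) ≡ n
  length≡ x@((ps , a , b) , isPart , bx , size) = trans (length-layout ps (padding x) a b) (m+[n∸m]≡n
    (≤-trans (layout-fits isPart bx) (subst (λ s → s + 2 ≤ n) (sym size) k+2≤n)))

  isGood : ∀ x → Good (toLayout x)
  isGood x@(_ , isPart , bx , _) = layout⇒good (padding x) isPart bx

  code : ∀ x → ∃ λ (cs : Code n) → toList cs ≡ toLayout x
  code x = fromList (good⇒valid (isGood x) (subst₂ _<_ (sym (sum≡ x)) (sym (length≡ x))
    (≤-trans (≤-trans (n≤1+n (suc k)) (≤-reflexive (+-comm 2 k))) k+2≤n))) (length≡ x)

  to : Shape → Setoid.Carrier (Av n k (p1324 ∷ p1432 ∷ []))
  to x = let cs , eq = code x in decode cs ,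
    trans (inversions-decode cs) (trans (cong sum eq) (sum≡ x)) ,
    avoidsW⁻ {π = decode cs} (good⇒avoids cs (subst Good (sym eq) (isGood x)))

  injective : ∀ x y → decode (proj₁ (code x)) Perm.≈ decode (proj₁ (code y)) → proj₁ x ≡ proj₁ y
  injective x@(_ , p , bx , _) y@(_ , q , by , _) eq
    with layout-injective (padding x) (padding y) p q bx by
           (trans (sym (proj₂ (code x))) (trans (cong toList (decode-injective _ _ eq)) (proj₂ (code y))))
  ... | refl , refl , refl = refl

  surjective : ∀ y → ∃ λ x → decode (proj₁ (code x)) Perm.≈ proj₁ y
  surjective (π , inv , avoids) with encode π
  ... | cs , π≈ with good⇒layout (avoids⇒good cs (subst (λ s → s + 2 ≤ n) (sym sum-cs) k+2≤n) av)
    where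
    sum-cs : sum (toList cs) ≡ k
    sum-cs = trans (sym (inversions-decode cs)) (trans (inversions-cong (decode cs) π π≈) inv)
    av : AvoidsW (val cs)
    av {i} {j} {k} {l} rewrite π≈ i | π≈ j | π≈ k | π≈ l = avoidsW⁺ {π = π} avoids
  ...   | ps , z , a , b , isPart , bx , eq = x , λ i →
    trans (cong (λ ds → decode ds ⟨$⟩ʳ i) (toList-injective _ _ (trans (proj₂ (code x)) same))) (π≈ i)
    where
    size : sum ps + b * a ≡ k
    size = trans (sym (sum-layout ps z a b)) (trans (cong sum (sym eq))
      (trans (sym (inversions-decode cs)) (trans (inversions-cong (decode cs) π π≈) inv)))
    x : Shape
    x = (ps , a , b) , isPart , bx , size
    same : toLayout x ≡ toList cs
    -- The number of zeros read off from the code must be the padding, since both layouts have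
    -- length `n`.
    same = trans (cong (λ z → layout ps z a b) (+-cancelˡ-≡ (suc (length ps + (b + a))) (padding x) z
      (trans (sym (length-layout ps (padding x) a b)) (trans (length≡ x)
      (trans (sym (length-toList cs)) (trans (cong length eq) (length-layout ps z a b))))))) (sym eq)

-- Inserting and removing the largest red part

Decreasing : List ℕ → Set
Decreasing = AllPairs _≥_

decreasing : ∀ {ps} → Linked _≥_ ps → Decreasing ps
decreasing = Linked⇒AllPairs (λ p q → ≤-trans q p)

partition : ∀ {ps} → Decreasing ps → All (_> 0) ps → IsPartition ps
partition dec pos = AllPairs⇒Linked dec , pos

above below : ℕ → List ℕ → List ℕ
above a = filter (a ≤?_)
below a = filter (_<? a)

all≥above : ∀ a ps → All (a ≤_) (above a ps)
all≥above a = All.all-filter (a ≤?_)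

all<below : ∀ a ps → All (_< a) (below a ps)
all<below a = All.all-filter (_<? a)

above-++ : ∀ {a us vs} → All (a ≤_) us → All (_< a) vs → above a (us ++ vs) ≡ us
above-++ {a} {us} {vs} u v = begin
  above a (us ++ vs)        ≡⟨ List.filter-++ (a ≤?_) us vs ⟩
  above a us ++ above a vs  ≡⟨ cong₂ _++_ (List.filter-all (a ≤?_) u) (List.filter-none (a ≤?_) (All.map <⇒≱ v)) ⟩
  us ++ []                  ≡⟨ List.++-identityʳ us ⟩
  us                        ∎
  where open ≡-Reasoning

below-++ : ∀ {a us vs} → All (a ≤_) us → All (_< a) vs → below a (us ++ vs) ≡ vs
below-++ {a} {us} {vs} u v = begin
  below a (us ++ vs)        ≡⟨ List.filter-++ (_<? a) us vs ⟩
  below a us ++ below a vs  ≡⟨ cong₂ _++_ (List.filter-none (_<? a) (All.map ≤⇒≯ u)) (List.filter-all (_<? a) v) ⟩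
  vs                        ∎
  where open ≡-Reasoning

above-++-below : ∀ a {ps} → Decreasing ps → above a ps ++ below a ps ≡ ps
above-++-below a []                  = refl
above-++-below a {p ∷ ps} (p≥ ∷ dec) with a ≤? p
... | yes a≤p = begin
  above a (p ∷ ps) ++ below a (p ∷ ps)
    ≡⟨ cong₂ _++_ (List.filter-accept (a ≤?_) a≤p) (List.filter-reject (_<? a) (≤⇒≯ a≤p)) ⟩
  p ∷ above a ps ++ below a ps          ≡⟨ cong (p ∷_) (above-++-below a dec) ⟩
  p ∷ ps                                ∎
  where open ≡-Reasoning
... | no a≰p = cong₂ _++_ (List.filter-none (a ≤?_) (All.map <⇒≱ all<)) (List.filter-all (_<? a) all<)
  where
  all< : All (_< a) (p ∷ ps)
  all< = ≰⇒> a≰p ∷ All.map (λ q≤p → ≤-<-trans q≤p (≰⇒> a≰p)) p≥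

replicate-++-injective : ∀ {a us vs} m n → All (_< a) us → All (_< a) vs →
  replicate m a ++ us ≡ replicate n a ++ vs → m ≡ n × us ≡ vs
replicate-++-injective zero    zero    u v eq = refl , eq
replicate-++-injective zero    (suc n) (p ∷ _) v refl = contradiction p (<-irrefl refl)
replicate-++-injective (suc m) zero    u (p ∷ _) refl = contradiction p (<-irrefl refl)
replicate-++-injective (suc m) (suc n) u v eq with replicate-++-injective m n u v (List.∷-injectiveʳ eq)
... | refl , eq′ = refl , eq′

-- The first red entry is `a`, and its run stops after `b` copies because the rest is strictly
-- smaller. Without a box `a` is 0, which forces `us` to be empty.
red-injective : ∀ {a b c d us vs} → Box a b → Box c d → All (_< a) us → All (_< c) vs →
  replicate b a ++ us ≡ replicate d c ++ vs → a ≡ c × b ≡ d × us ≡ vs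
red-injective none none u v eq = refl , refl , eq
red-injective none (some {b = suc _} _ _) (() ∷ _) v refl
red-injective (some {b = suc _} _ _) none u (() ∷ _) refl
red-injective {b = b} {d = d} (some {b = suc _} _ _) (some {b = suc _} _ _) u v eq with List.∷-injectiveˡ eq
... | refl with replicate-++-injective b d u v eq
...   | p , q = refl , p , q

multiplicity : ∀ {a xs} → All (_≤ a) xs → Decreasing xs → ∃ λ b → ∃ λ ys → xs ≡ replicate b a ++ ys × All (_< a) ys
multiplicity [] [] = 0 , [] , refl , []
multiplicity {a} {x ∷ xs} (x≤a ∷ p) (x≥ ∷ dec) with x ≟ a
... | yes refl = let b , ys , eq , q = multiplicity p dec in suc b , ys , cong (x ∷_) eq , q
... | no x≢a   = let x<a = ≤∧≢⇒< x≤a x≢a in 0 , x ∷ xs , refl , x<a ∷ All.map (λ q → ≤-<-trans q x<a) x≥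

red-decompose : ∀ {xs} → Decreasing xs → All (_> 0) xs →
  ∃ λ a → ∃ λ b → ∃ λ ys → Box a b × xs ≡ replicate b a ++ ys × All (_< a) ys
red-decompose [] [] = 0 , 0 , [] , none , refl , []
red-decompose {x ∷ xs} (x≥ ∷ dec) (0<x ∷ _) =
  let b , ys , eq , p = multiplicity x≥ dec in x , suc b , ys , some 0<x z<s , cong (x ∷_) eq , p

all-replicate : ∀ {a b} → Box a b → {P : ℕ → Set} → (0 < a → P a) → All P (replicate b a)
all-replicate none       f = []
all-replicate (some p _) f = All.replicate⁺ _ (f p)

shapes↔BlueAboveRed : ∀ k → Inverse (Shapes k) (BlueAboveRed k)
shapes↔BlueAboveRed k = bijective⇒inverse (Shapes k) (BlueAboveRed k)
  (λ x → colour (proj₁ x) , valid x) (cong colour) (λ {x} {y} → injective x y) surjective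
  where
  Shape = Setoid.Carrier (Shapes k)

  colour : List ℕ × ℕ × ℕ → List ℕ × List ℕ
  -- Parts of `ps` equal to `a` become blue, so the red multiplicity of `a` is exactly `b`. For the
  -- absent box `a` is 0 and every part is blue.
  colour (ps , a , b) = above a ps , replicate b a ++ below a ps

  valid : (x : Shape) → let blue , red = colour (proj₁ x) in
          IsBlueRedPartition k (blue , red) × All (λ b → All (b ≥_) red) blue
  valid ((ps , a , b) , (l , pos) , bx , size) =
    (partition (AllPairs.filter⁺ (a ≤?_) dec) (All.filter⁺ (a ≤?_) pos) ,
     partition (AllPairs.++⁺ (replicate-decreasing b) (AllPairs.filter⁺ (_<? a) dec)
                 (All.replicate⁺ b (All.map <⇒≤ (all<below a ps))))
               (All.++⁺ (all-replicate bx id) (All.filter⁺ (_<? a) pos)) ,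
     sum≡) ,
    All.map (λ a≤p → All.++⁺ (All.replicate⁺ b a≤p) (All.map (λ q<a → ≤-trans (<⇒≤ q<a) a≤p) (all<below a ps)))
            (all≥above a ps)
    where
    open ≡-Reasoning
    dec = decreasing l
    replicate-decreasing : ∀ b → Decreasing (replicate b a)
    replicate-decreasing zero    = []
    replicate-decreasing (suc b) = All.replicate⁺ b ≤-refl ∷ replicate-decreasing b
    sum≡ : sum (above a ps) + sum (replicate b a ++ below a ps) ≡ k
    sum≡ = begin
      sum (above a ps) + sum (replicate b a ++ below a ps)
        ≡⟨ cong (sum (above a ps) +_) (trans (sum-++ (replicate b a) _) (trans (cong (_+ _) (sum-replicate b a)) (+-comm (b * a) _))) ⟩
      sum (above a ps) + (sum (below a ps) + b * a)   ≡⟨ +-assoc (sum (above a ps)) _ _ ⟨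
      sum (above a ps) + sum (below a ps) + b * a     ≡⟨ cong (_+ b * a) (sum-++ (above a ps) _) ⟨
      sum (above a ps ++ below a ps) + b * a          ≡⟨ cong (λ qs → sum qs + b * a) (above-++-below a dec) ⟩
      sum ps + b * a                                  ≡⟨ size ⟩
      k                                               ∎

  injective : ∀ x y → colour (proj₁ x) ≡ colour (proj₁ y) → proj₁ x ≡ proj₁ y
  injective ((ps , a , b) , (l , _) , bx , _) ((qs , c , d) , (m , _) , by , _) eq
    with red-injective bx by (all<below a ps) (all<below c qs) (cong proj₂ eq)
  ... | refl , refl , eq′ = cong (_, a , b)
    (trans (sym (above-++-below a (decreasing l))) (trans (cong₂ _++_ (cong proj₁ eq) eq′) (above-++-below a (decreasing m))))

  surjective : ∀ y → ∃ λ x → colour (proj₁ x) ≡ proj₁ y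
  surjective ((blue , red) , ((lb , pb) , (lr , pr) , size) , blue≥red) with red-decompose (decreasing lr) pr
  ... | a , b , ys , bx , refl , ys<a = ((blue ++ ys , a , b) ,
      partition (AllPairs.++⁺ (decreasing lb) dec-ys (All.map (All.++⁻ʳ (replicate b a)) blue≥red))
                (All.++⁺ pb (All.++⁻ʳ (replicate b a) pr)) , bx , sum≡) ,
      cong₂ _,_ (above-++ blue≥a ys<a) (cong (replicate b a ++_) (below-++ blue≥a ys<a))
    where
    open ≡-Reasoning
    drop-decreasing : ∀ m {xs} → Decreasing (replicate m a ++ xs) → Decreasing xs
    drop-decreasing zero    dec       = dec
    drop-decreasing (suc m) (_ ∷ dec) = drop-decreasing m dec
    dec-ys = drop-decreasing b (decreasing lr)
    blue≥a : All (a ≤_) blue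
    blue≥a = All.map (λ {x} → bound x bx) blue≥red
      where
      bound : ∀ x {a b ys} → Box a b → All (x ≥_) (replicate b a ++ ys) → a ≤ x
      bound x none                   _       = z≤n
      bound x (some {b = suc _} _ _) (p ∷ _) = p
    sum≡ : sum (blue ++ ys) + b * a ≡ k
    sum≡ = begin
      sum (blue ++ ys) + b * a              ≡⟨ cong (_+ b * a) (sum-++ blue ys) ⟩
      sum blue + sum ys + b * a             ≡⟨ +-assoc (sum blue) _ _ ⟩
      sum blue + (sum ys + b * a)           ≡⟨ cong (sum blue +_) (+-comm _ (b * a)) ⟩
      sum blue + (b * a + sum ys)           ≡⟨ cong (λ s → sum blue + (s + sum ys)) (sum-replicate b a) ⟨
      sum blue + (sum (replicate b a) + sum ys) ≡⟨ cong (sum blue +_) (sum-++ (replicate b a) ys) ⟨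
      sum blue + sum (replicate b a ++ ys)  ≡⟨ size ⟩
      k                                     ∎

-- Counting coloured partitions

module _ {A B : Set} {f : A → List B} where
  ∈-concatMap : ∀ {x y xs} → x ∈ xs → y ∈ f x → y ∈ concatMap f xs
  ∈-concatMap x∈xs y∈fx = ∈-concatMap⁺ f (lose x∈xs y∈fx)

  ∈-concatMap-witness : ∀ {y} xs → y ∈ concatMap f xs → ∃ λ x → x ∈ xs × y ∈ f x
  ∈-concatMap-witness xs y∈ = find (∈-concatMap⁻ f {xs = xs} y∈)

  concatMap-unique : ∀ {xs} → Unique xs → (∀ x → Unique (f x)) → (∀ {x x′ y} → y ∈ f x → y ∈ f x′ → x ≡ x′) →
                     Unique (concatMap f xs)
  concatMap-unique []                 u inj = []
  concatMap-unique {x ∷ xs} (x∉ ∷ xs!) u inj = Unique.++⁺ (u x) (concatMap-unique xs! u inj) λ (y∈ , y∈′) →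
    let x′ , x′∈ , y∈fx′ = ∈-concatMap-witness xs y∈′ in All.lookup x∉ x′∈ (inj y∈ y∈fx′)

  length-concatMap-const : ∀ {m} xs → (∀ {x} → x ∈ xs → length (f x) ≡ m) → length (concatMap f xs) ≡ length xs * m
  length-concatMap-const []       p = refl
  length-concatMap-const (x ∷ xs) p = trans (List.length-++ (f x)) (cong₂ _+_ (p (here refl)) (length-concatMap-const xs (p ∘ there)))

length-concatMap-applyUpTo : ∀ {B : Set} (f : ℕ → List B) g n →
  length (concatMap f (applyUpTo g n)) ≡ sum (applyUpTo (length ∘ f ∘ g) n)
length-concatMap-applyUpTo f g zero    = refl
length-concatMap-applyUpTo f g (suc n) =
  trans (List.length-++ (f (g 0))) (cong (length (f (g 0)) +_) (length-concatMap-applyUpTo f (g ∘ suc) n))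

mutual
  -- The weakly decreasing lists of length j with a times the first entry plus
  -- the sum equal to m. In terms of the successive differences of the list
  -- this is a partition of m into the parts a + 1, …, a + j.
  staircases : ℕ → ℕ → ℕ → List (List ℕ)
  staircases a zero    zero    = [] ∷ []
  staircases a zero    (suc m) = []
  staircases a (suc j) m       = concatMap (λ i → branch a j m i (suc a ∣? i)) (upTo (suc m))

  branch : ∀ a j m i → Dec (suc a ∣ i) → List (List ℕ)
  branch a j m i (yes (divides q _)) = map (λ ys → q + hd ys ∷ ys) (staircases (suc a) j (m ∸ i))
  branch a j m i (no _)              = []

Staircase : ℕ → ℕ → ℕ → List ℕ → Set
Staircase a j m xs = length xs ≡ j × Linked _≥_ xs × a * hd xs + sum xs ≡ m

-- Here `h` is the second entry and `q` the first difference. Splitting off `q` copies of the part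
-- `suc a` leaves the same kind of weight with `suc a` in place of `a`.
stair-sum : ∀ a q h s → a * (q + h) + (q + h + s) ≡ q * suc a + (suc a * h + s)
stair-sum a q h s = begin
  a * (q + h) + (q + h + s)      ≡⟨ +-assoc (a * (q + h)) (q + h) s ⟨
  a * (q + h) + (q + h) + s      ≡⟨ cong (_+ s) (+-comm (a * (q + h)) (q + h)) ⟩
  suc a * (q + h) + s            ≡⟨ cong (_+ s) (*-distribˡ-+ (suc a) q h) ⟩
  suc a * q + suc a * h + s      ≡⟨ +-assoc (suc a * q) _ s ⟩
  suc a * q + (suc a * h + s)    ≡⟨ cong (_+ (suc a * h + s)) (*-comm (suc a) q) ⟩
  q * suc a + (suc a * h + s)    ∎
  where open ≡-Reasoning

staircases-sound : ∀ a j m {xs} → xs ∈ staircases a j m → Staircase a j m xs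
staircases-sound a zero    zero    (here refl) = refl , [] , trans (+-identityʳ _) (*-zeroʳ a)
staircases-sound a (suc j) m xs∈ with ∈-concatMap-witness (upTo (suc m)) xs∈
... | i , i∈ , xs∈′ with suc a ∣? i
...   | yes (divides q refl) with ∈-map⁻ _ xs∈′
...     | ys , ys∈ , refl with staircases-sound (suc a) j (m ∸ q * suc a) ys∈
...       | len , l , eq = cong suc len , linked-∷ (m≤n+m _ q) l ,
  trans (stair-sum a q (hd ys) (sum ys)) (trans (cong (q * suc a +_) eq) (m+[n∸m]≡n (s≤s⁻¹ (∈-upTo⁻ i∈))))

staircases-complete : ∀ a j m {xs} → Staircase a j m xs → xs ∈ staircases a j m
staircases-complete a zero    m {[]} (refl , _ , refl) = subst (λ m → [] ∈ staircases a 0 m) (sym (trans (+-identityʳ (a * 0)) (*-zeroʳ a))) (here refl)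
staircases-complete a (suc j) m {x ∷ ys} (refl , l , eq) = ∈-concatMap (∈-upTo⁺ (s≤s i≤m)) ∈branch
  where
  q = x ∸ hd ys
  i = q * suc a
  x≡ : q + hd ys ≡ x
  x≡ = m∸n+n≡m (linked-hd l)
  total : i + (suc a * hd ys + sum ys) ≡ m
  total = trans (sym (stair-sum a q (hd ys) (sum ys))) (trans (cong (λ x → a * x + (x + sum ys)) x≡) eq)
  i≤m : i ≤ m
  i≤m = subst (i ≤_) total (m≤m+n i _)
  ys∈ : ys ∈ staircases (suc a) j (m ∸ i)
  ys∈ = staircases-complete (suc a) j (m ∸ i) (refl , linked-tail l , sym (trans (cong (_∸ i) (sym total)) (m+n∸m≡n i _)))
  ∈branch : x ∷ ys ∈ branch a j m i (suc a ∣? i)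
  ∈branch with suc a ∣? i
  ... | no ¬d = contradiction (divides q refl) ¬d
  ... | yes (divides q′ eq′) = subst (λ x → x ∷ ys ∈ map (λ ys → q′ + hd ys ∷ ys) (staircases (suc a) j (m ∸ i)))
          (trans (cong (_+ hd ys) (*-cancelʳ-≡ q′ q (suc a) (sym eq′))) x≡) (∈-map⁺ (λ ys → q′ + hd ys ∷ ys) ys∈)

staircases-unique : ∀ a j m → Unique (staircases a j m)
staircases-unique a zero    zero    = [] ∷ []
staircases-unique a zero    (suc m) = []
staircases-unique a (suc j) m       = concatMap-unique (Unique.upTo⁺ (suc m)) unique disjoint
  where
  unique : ∀ i → Unique (branch a j m i (suc a ∣? i))
  unique i with suc a ∣? i
  ... | yes (divides q _) = Unique.map⁺ List.∷-injectiveʳ (staircases-unique (suc a) j (m ∸ i))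
  ... | no _ = []
  step : ∀ {i xs} → xs ∈ branch a j m i (suc a ∣? i) → ∃ λ ys → ∃ λ q → xs ≡ q + hd ys ∷ ys × i ≡ q * suc a
  step {i} xs∈ with suc a ∣? i
  ... | yes (divides q eq) with ys , _ , eq′ ← ∈-map⁻ _ xs∈ = ys , q , eq′ , eq
  disjoint : ∀ {i i′ xs} → xs ∈ branch a j m i (suc a ∣? i) → xs ∈ branch a j m i′ (suc a ∣? i′) → i ≡ i′
  disjoint {i} {i′} xs∈ xs∈′ with step {i} xs∈ | step {i′} xs∈′
  ... | ys , q , refl , refl | zs , q′ , eq , refl with List.∷-injective eq
  -- The list determines its first difference, hence the multiple of `suc a` it came from.
  ...   | eq′ , refl = cong (_* suc a) (+-cancelʳ-≡ (hd ys) q q′ eq′)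

length-branch : ∀ a j m i (d : Dec (suc a ∣ i)) → length (branch a j m i d) ≡ ⟦ d ⟧ * length (staircases (suc a) j (m ∸ i))
length-branch a j m i (yes (divides q _)) = trans (List.length-map _ (staircases (suc a) j (m ∸ i))) (sym (+-identityʳ _))
length-branch a j m i (no _)              = refl

-- This is a Cauchy product: the indicator is the coefficient of 1/(1 - x^(a+1)), so the recursion
-- is the one that unfolds the product of geometric series.
length-staircases : ∀ a j m → length (staircases a (suc j) m)
                              ≡ sum (applyUpTo (λ i → ⟦ suc a ∣? i ⟧ * length (staircases (suc a) j (m ∸ i))) (suc m))
length-staircases a j m = trans (length-concatMap-applyUpTo (λ i → branch a j m i (suc a ∣? i)) id (suc m))
  (cong sum (applyUpTo-cong (suc m) λ i → length-branch a j m i (suc a ∣? i)))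
  where
  applyUpTo-cong : ∀ {f g : ℕ → ℕ} n → f ≗ g → applyUpTo f n ≡ applyUpTo g n
  applyUpTo-cong zero    p = refl
  applyUpTo-cong (suc n) p = cong₂ _∷_ (p 0) (applyUpTo-cong n (p ∘ suc))

-- Colourings of one partition: as blue dominates red, a colouring is a cut of the decreasing
-- listing into a blue prefix and a red suffix.
splits : ∀ {A : Set} → List A → List (List A × List A)
splits []       = ([] , []) ∷ []
splits (x ∷ xs) = ([] , x ∷ xs) ∷ map (λ (us , vs) → x ∷ us , vs) (splits xs)

length-splits : ∀ {A : Set} (xs : List A) → length (splits xs) ≡ suc (length xs)
length-splits []       = refl
length-splits (x ∷ xs) = cong suc (trans (List.length-map _ (splits xs)) (length-splits xs))

splits-sound : ∀ {A : Set} (xs : List A) {us vs} → (us , vs) ∈ splits xs → us ++ vs ≡ xs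
splits-sound []       (here refl) = refl
splits-sound (x ∷ xs) (here refl) = refl
splits-sound (x ∷ xs) (there p) with ∈-map⁻ _ p
... | (us , vs) , q , refl = cong (x ∷_) (splits-sound xs q)

splits-complete : ∀ {A : Set} (us : List A) {vs} → (us , vs) ∈ splits (us ++ vs)
splits-complete []       {[]}    = here refl
splits-complete []       {_ ∷ _} = here refl
splits-complete (u ∷ us)         = there (∈-map⁺ _ (splits-complete us))

splits-unique : ∀ {A : Set} (xs : List A) → Unique (splits xs)
splits-unique []       = [] ∷ []
splits-unique (x ∷ xs) = All.map⁺ (All.universal (λ _ ()) (splits xs)) ∷
  Unique.map⁺ (λ {y} {z} eq → cong₂ _,_ (List.∷-injectiveʳ (cong proj₁ eq)) (cong proj₂ eq)) (splits-unique xs)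

-- Subtracting 1 from each of the j parts leaves a weakly decreasing list of
-- length j.
blueReds : ℕ → ℕ → List (List ℕ × List ℕ)
blueReds k j = concatMap (splits ∘ map suc) (staircases 0 j (k ∸ j))

allBlueReds : ℕ → List (List ℕ × List ℕ)
allBlueReds k = concatMap (blueReds k) (upTo (suc k))

count : ℕ → ℕ
count k = sum (applyUpTo (λ j → length (staircases 0 j (k ∸ j)) * suc j) (suc k))

length-allBlueReds : ∀ k → length (allBlueReds k) ≡ count k
length-allBlueReds k = trans (length-concatMap-applyUpTo (blueReds k) id (suc k)) (cong sum (go id (suc k)))
  where
  size : ∀ j → length (blueReds k j) ≡ length (staircases 0 j (k ∸ j)) * suc j
  size j = length-concatMap-const {f = splits ∘ map suc} (staircases 0 j (k ∸ j)) λ {ys} ys∈ →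
    trans (length-splits (map suc ys)) (cong suc (trans (List.length-map suc ys) (proj₁ (staircases-sound 0 j (k ∸ j) ys∈))))
  go : ∀ g n → applyUpTo (length ∘ blueReds k ∘ g) n ≡ applyUpTo (λ i → length (staircases 0 (g i) (k ∸ g i)) * suc (g i)) n
  go g zero    = refl
  go g (suc n) = cong₂ _∷_ (size (g 0)) (go (g ∘ suc) n)

sum-map-suc : ∀ xs → sum (map suc xs) ≡ length xs + sum xs
sum-map-suc []       = refl
sum-map-suc (x ∷ xs) = cong suc (trans (cong (x +_) (sum-map-suc xs)) (trans (sym (+-assoc x _ _))
  (trans (cong (_+ sum xs) (+-comm x _)) (+-assoc (length xs) x _))))

map-suc-pred : ∀ {xs} → All (_> 0) xs → map suc (map pred xs) ≡ xs
map-suc-pred []                  = refl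
map-suc-pred {suc x ∷ xs} (p ∷ pos) = cong (suc x ∷_) (map-suc-pred pos)

linked-map : ∀ {f : ℕ → ℕ} → (∀ {x y} → x ≥ y → f x ≥ f y) → ∀ {xs} → Linked _≥_ xs → Linked _≥_ (map f xs)
linked-map mono []      = []
linked-map mono [-]     = [-]
linked-map mono (p ∷ l) = mono p ∷ linked-map mono l

++-decreasing⁻ : ∀ us {vs} → AllPairs _≥_ (us ++ vs) → AllPairs _≥_ us × AllPairs _≥_ vs × All (λ u → All (u ≥_) vs) us
++-decreasing⁻ []       d        = [] , d , []
++-decreasing⁻ (u ∷ us) (p ∷ d) with ++-decreasing⁻ us d
... | d₁ , d₂ , q = All.++⁻ˡ us p ∷ d₁ , d₂ , All.++⁻ʳ us p ∷ q

BlueRed : ℕ → List ℕ × List ℕ → Set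
BlueRed k (blue , red) = IsBlueRedPartition k (blue , red) × All (λ b → All (b ≥_) red) blue

blueRed⇒partition : ∀ {k us vs} → BlueRed k (us , vs) → IsPartition (us ++ vs) × sum (us ++ vs) ≡ k
blueRed⇒partition {us = us} {vs} (((l₁ , p₁) , (l₂ , p₂) , size) , q) =
  (partition (AllPairs.++⁺ (decreasing l₁) (decreasing l₂) q) (All.++⁺ p₁ p₂)) , trans (sum-++ us vs) size

partition⇒blueRed : ∀ {k} us {vs} → IsPartition (us ++ vs) → sum (us ++ vs) ≡ k → BlueRed k (us , vs)
partition⇒blueRed us {vs} (l , pos) size with ++-decreasing⁻ us (decreasing l)
... | d₁ , d₂ , q = (partition d₁ (All.++⁻ˡ us pos) , partition d₂ (All.++⁻ʳ us pos) , trans (sym (sum-++ us vs)) size) , q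

allBlueReds-sound : ∀ k {x} → x ∈ allBlueReds k → BlueRed k x
allBlueReds-sound k {us , vs} x∈ with ∈-concatMap-witness {f = blueReds k} (upTo (suc k)) x∈
... | j , j∈ , x∈′ with ∈-concatMap-witness {f = splits ∘ map suc} (staircases 0 j (k ∸ j)) x∈′
...   | ys , ys∈ , x∈″ with staircases-sound 0 j (k ∸ j) ys∈
...     | len , l , total = partition⇒blueRed us (subst IsPartition (sym eq) (linked-map s≤s l , All.map⁺ (All.universal (λ _ → z<s) ys)))
  (trans (cong sum eq) (trans (sum-map-suc ys) (trans (cong₂ _+_ len total) (m+[n∸m]≡n (s≤s⁻¹ (∈-upTo⁻ j∈))))))
  where
  eq : us ++ vs ≡ map suc ys
  eq = splits-sound (map suc ys) x∈″

allBlueReds-complete : ∀ k {x} → BlueRed k x → x ∈ allBlueReds k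
allBlueReds-complete k {us , vs} p with blueRed⇒partition p
... | (l , pos) , size = ∈-concatMap {f = blueReds k} (∈-upTo⁺ (s≤s j≤k))
    (∈-concatMap {f = splits ∘ map suc} ys∈
      (subst (λ xs → (us , vs) ∈ splits xs) (sym (map-suc-pred pos)) (splits-complete us)))
  where
  ys = map pred (us ++ vs)
  j  = length ys
  total : j + sum ys ≡ k
  total = trans (sym (sum-map-suc ys)) (trans (cong sum (map-suc-pred pos)) size)
  j≤k : j ≤ k
  j≤k = subst (j ≤_) total (m≤m+n j _)
  ys∈ : ys ∈ staircases 0 j (k ∸ j)
  ys∈ = staircases-complete 0 j (k ∸ j) (refl , linked-map pred-mono-≤ l , trans (sym (m+n∸m≡n j _)) (cong (_∸ j) total))

-- Rejoining blue and red recovers the partition, and its length recovers `j`, so different branches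
-- cannot meet.
allBlueReds-unique : ∀ k → Unique (allBlueReds k)
allBlueReds-unique k = concatMap-unique (Unique.upTo⁺ (suc k))
  (λ j → concatMap-unique (staircases-unique 0 j (k ∸ j)) (λ ys → splits-unique (map suc ys))
    (λ {ys} {zs} p q → List.map-injective suc-injective (trans (sym (splits-sound (map suc ys) p)) (splits-sound (map suc zs) q))))
  (λ {i} {j} p q → trans (sym (len i p)) (len j q))
  where
  len : ∀ j {x} → x ∈ blueReds k j → length (proj₁ x ++ proj₂ x) ≡ j
  len j {us , vs} x∈ with ∈-concatMap-witness {f = splits ∘ map suc} (staircases 0 j (k ∸ j)) x∈
  ... | ys , ys∈ , x∈′ = trans (cong length (splits-sound (map suc ys) x∈′))
    (trans (List.length-map suc ys) (proj₁ (staircases-sound 0 j (k ∸ j) ys∈)))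

BlueAboveRed-size : ∀ k → HasSize (BlueAboveRed k) (count k)
BlueAboveRed-size k = subst (HasSize (BlueAboveRed k)) (length-allBlueReds k)
  (enumeration⇒hasSize {P = BlueRed k} (allBlueReds k) (allBlueReds-unique k) (allBlueReds-sound k) (allBlueReds-complete k))



Av-size : ∀ k n → n ≥ k + 2 → HasSize (Av n k (p1324 ∷ p1432 ∷ [])) (count k)
Av-size k n k+2≤n = Composition.inverse (Symmetry.inverse (shapes↔Av k n k+2≤n))
  (Composition.inverse (shapes↔BlueAboveRed k) (BlueAboveRed-size k))

-- The generating function

open import Data.Integer.Base using (+_)
open SemiringSum ℤ.+-*-semiring
  using (sum-syntax; sum⁺-syntax; sum-cong-≗; sum-replicate-zero; *-distribˡ-sum)

∑-all-0 : ∀ n {f : Fin n → ℤ} → (∀ i → f i ≡ 0ℤ) → (∑[ i < n ] f i) ≡ 0ℤ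
∑-all-0 n p = trans (sum-cong-≗ {n} p) (sum-replicate-zero n)

X^-pick : ∀ a n (h : ℕ → ℤ) → a ≤ n → (∑[ i ≤ n ] ((X^ a) (toℕ i) ℤ.* h (toℕ i))) ≡ h a
X^-pick zero n h _ = begin
  1ℤ ℤ.* h 0 ℤ.+ (∑[ i < n ] (0ℤ ℤ.* h (suc (toℕ i))))
    ≡⟨ cong₂ ℤ._+_ (ℤ.*-identityˡ (h 0)) (∑-all-0 n λ i → ℤ.*-zeroˡ (h (suc (toℕ i)))) ⟩
  h 0 ℤ.+ 0ℤ  ≡⟨ ℤ.+-identityʳ (h 0) ⟩
  h 0         ∎
  where open ≡-Reasoning
X^-pick (suc a) (suc n) h (s≤s a≤n) = trans (cong (ℤ._+ rest) (ℤ.*-zeroˡ (h 0)))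
  (trans (ℤ.+-identityˡ rest) (X^-pick a n (h ∘ suc) a≤n))
  where rest = ∑[ i ≤ n ] ((X^ a) (toℕ i) ℤ.* h (suc (toℕ i)))

X^-none : ∀ a n (h : ℕ → ℤ) → n < a → (∑[ i ≤ n ] ((X^ a) (toℕ i) ℤ.* h (toℕ i))) ≡ 0ℤ
X^-none (suc a) n h n<a = trans (cong (ℤ._+ rest n) (ℤ.*-zeroˡ (h 0))) (trans (ℤ.+-identityˡ (rest n)) (vanish n n<a))
  where
  rest : ℕ → ℤ
  rest n = ∑[ i < n ] ((X^ a) (toℕ i) ℤ.* h (suc (toℕ i)))
  vanish : ∀ n → n < suc a → rest n ≡ 0ℤ
  vanish zero    _         = refl
  vanish (suc n) (s≤s n<a) = X^-none a n (h ∘ suc) n<a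

-- The minus sign in the recursion for inverses cancels against that of -x^(a+1), whose coefficients
-- from degree 1 on are those of -x^a.
inv-geometric-suc : ∀ a n → inv (𝟏 ⊖ (X^ suc a)) (suc n) ≡ (∑[ i ≤ n ] ((X^ a) (toℕ i) ℤ.* inv (𝟏 ⊖ (X^ suc a)) (n ∸ toℕ i)))
inv-geometric-suc a n = begin
  ℤ.- (∑[ i ≤ n ] ((0ℤ ℤ.- x i) ℤ.* Vec.lookup (invPrefix f n) i))
    ≡⟨ cong ℤ.-_ (sum-cong-≗ {suc n} λ i → cong ((0ℤ ℤ.- x i) ℤ.*_) (lookup-invPrefix f n i)) ⟩
  ℤ.- (∑[ i ≤ n ] ((0ℤ ℤ.- x i) ℤ.* y i))
    ≡⟨ cong ℤ.-_ (sum-cong-≗ {suc n} λ i → trans (cong (ℤ._* y i) (trans (ℤ.+-identityˡ (ℤ.- x i)) (sym (ℤ.-1*i≡-i (x i))))) (ℤ.*-assoc ℤ.-1ℤ (x i) (y i))) ⟩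
  ℤ.- (∑[ i ≤ n ] (ℤ.-1ℤ ℤ.* (x i ℤ.* y i)))
    ≡⟨ cong ℤ.-_ (*-distribˡ-sum {suc n} ℤ.-1ℤ (λ i → x i ℤ.* y i)) ⟨
  ℤ.- (ℤ.-1ℤ ℤ.* (∑[ i ≤ n ] (x i ℤ.* y i)))
    ≡⟨ cong ℤ.-_ (ℤ.-1*i≡-i _) ⟩
  ℤ.- (ℤ.- (∑[ i ≤ n ] (x i ℤ.* y i)))
    ≡⟨ ℤ.neg-involutive _ ⟩
  (∑[ i ≤ n ] (x i ℤ.* y i)) ∎
  where
  open ≡-Reasoning
  f = 𝟏 ⊖ (X^ suc a)
  x y : Fin (suc n) → ℤ
  x i = (X^ a) (toℕ i)
  y i = inv f (n ∸ toℕ i)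

-- The sum in `inv-geometric-suc` has at most one nonzero term, at `n ∸ a`, which is `suc n` lowered
-- by `suc a`; the step back keeps divisibility. If `a > n` the sum is empty of terms, and `suc n`
-- is too small to be a multiple.
inv-geometric : ∀ a n → inv (𝟏 ⊖ (X^ suc a)) n ≡ + ⟦ suc a ∣? n ⟧
inv-geometric a = <-rec _ go
  where
  f = 𝟏 ⊖ (X^ suc a)
  go : ∀ n → (∀ {m} → m < n → inv f m ≡ + ⟦ suc a ∣? m ⟧) → inv f n ≡ + ⟦ suc a ∣? n ⟧
  go zero    ih = cong +_ (⟦⟧-cong (yes (suc a ∣0)) (suc a ∣? 0) (mk⇔ id id))
  go (suc n) ih with a ≤? n
  ... | yes a≤n = begin
    inv f (suc n)           ≡⟨ inv-geometric-suc a n ⟩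
    (∑[ i ≤ n ] ((X^ a) (toℕ i) ℤ.* inv f (n ∸ toℕ i))) ≡⟨ X^-pick a n (λ i → inv f (n ∸ i)) a≤n ⟩
    inv f (n ∸ a)           ≡⟨ ih (s≤s (m∸n≤m n a)) ⟩
    + ⟦ suc a ∣? n ∸ a ⟧    ≡⟨ cong +_ (⟦⟧-cong (suc a ∣? n ∸ a) (suc a ∣? suc n)
                                 (mk⇔ (λ d → subst (suc a ∣_) split (∣m∣n⇒∣m+n ∣-refl d))
                                      (λ d → ∣m+n∣m⇒∣n (subst (suc a ∣_) (sym split) d) ∣-refl))) ⟩
    + ⟦ suc a ∣? suc n ⟧    ∎
    where
    open ≡-Reasoning
    split : suc a + (n ∸ a) ≡ suc n
    split = cong suc (m+[n∸m]≡n a≤n)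
  ... | no a≰n = begin
    inv f (suc n)           ≡⟨ inv-geometric-suc a n ⟩
    (∑[ i ≤ n ] ((X^ a) (toℕ i) ℤ.* inv f (n ∸ toℕ i))) ≡⟨ X^-none a n (λ i → inv f (n ∸ i)) (≰⇒> a≰n) ⟩
    0ℤ                      ≡⟨ cong +_ (⟦⟧-cong (no a≰n) (suc a ∣? suc n) (mk⇔ (λ p → contradiction p a≰n) (λ d → s≤s⁻¹ (∣⇒≤ d)))) ⟩
    + ⟦ suc a ∣? suc n ⟧    ∎
    where open ≡-Reasoning

∑-applyUpTo : ∀ {M N} → N ≤ M → (g : ℕ → ℤ) (t : ℕ → ℕ) → (∀ j → j < N → g j ≡ + t j) →
              (∀ j → N ≤ j → j < M → g j ≡ 0ℤ) → (∑[ j < M ] g (toℕ j)) ≡ + sum (applyUpTo t N)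
∑-applyUpTo {M} z≤n g t p q = ∑-all-0 M λ j → q (toℕ j) z≤n (Fin.toℕ<n j)
∑-applyUpTo (s≤s N≤M) g t p q = cong₂ ℤ._+_ (p 0 z<s)
  (∑-applyUpTo N≤M (g ∘ suc) (t ∘ suc) (λ j r → p (suc j) (s<s r)) (λ j r r′ → q (suc j) (s≤s r) (s<s r′)))

-- The exponents form a family `e` known only up to equality, since peeling off a factor yields
-- `e ∘ suc`, which is not definitionally the family for `suc a`.
∏-geometric : ∀ a j (e : Fin j → ℕ) → (∀ i → e i ≡ suc (a + toℕ i)) → ∀ n →
              foldr _⊛_ 𝟏 (λ i → inv (𝟏 ⊖ (X^ e i))) n ≡ + length (staircases a j n)
∏-geometric a zero    e p zero    = refl
∏-geometric a zero    e p (suc n) = refl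
∏-geometric a (suc j) e p n       = trans
  (∑-applyUpTo {suc n} ≤-refl (λ i → inv (𝟏 ⊖ (X^ e zero)) i ℤ.* rest (n ∸ i)) t (λ i _ → coefficient i)
    (λ i n<i i<1+n → contradiction i<1+n (≤⇒≯ n<i)))
  (cong +_ (sym (length-staircases a j n)))
  where
  open ≡-Reasoning
  rest : Series
  rest = foldr _⊛_ 𝟏 (λ i → inv (𝟏 ⊖ (X^ e (suc i))))
  t : ℕ → ℕ
  t i = ⟦ suc a ∣? i ⟧ * length (staircases (suc a) j (n ∸ i))
  coefficient : ∀ i → inv (𝟏 ⊖ (X^ e zero)) i ℤ.* rest (n ∸ i) ≡ + t i
  coefficient i = begin
    inv (𝟏 ⊖ (X^ e zero)) i ℤ.* rest (n ∸ i)
      ≡⟨ cong₂ ℤ._*_ (trans (cong (λ d → inv (𝟏 ⊖ (X^ d)) i) (trans (p zero) (cong suc (+-identityʳ a)))) (inv-geometric a i))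
                     (∏-geometric (suc a) j (e ∘ suc) (λ i → trans (p (suc i)) (cong suc (+-suc a (toℕ i)))) (n ∸ i)) ⟩
    + ⟦ suc a ∣? i ⟧ ℤ.* + length (staircases (suc a) j (n ∸ i))
      ≡⟨ ℤ.pos-* ⟦ suc a ∣? i ⟧ _ ⟨
    + t i ∎

shifted : ∀ c k (H : Series) n → (c · (X^ k) ⊛ H) n ≡ (∑[ i ≤ n ] ((X^ k) (toℕ i) ℤ.* (c ℤ.* H (n ∸ toℕ i))))
shifted c k H n = sum-cong-≗ {suc n} λ i →
  trans (cong (ℤ._* H (n ∸ toℕ i)) (ℤ.*-comm c ((X^ k) (toℕ i)))) (ℤ.*-assoc ((X^ k) (toℕ i)) c _)

count-series : (λ k → (+ (k + 1)) · (X^ k) ⊛ (∏[ k ] (λ i → inv (𝟏 ⊖ (X^ i))))) SumsTo generatingFunction count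
-- The factor x^k removes every term with `k > n` from the coefficient at `n`, so the partial sums
-- are constant from `suc n` on.
count-series n = suc n , λ M n<M → ∑-applyUpTo n<M
  (λ k → ((+ (k + 1)) · (X^ k) ⊛ H k) n) (λ k → length (staircases 0 k (n ∸ k)) * suc k)
  (λ k k≤n → low k (s≤s⁻¹ k≤n)) (λ k n<k _ → trans (shifted (+ (k + 1)) k (H k) n) (X^-none k n (λ i → + (k + 1) ℤ.* H k (n ∸ i)) n<k))
  where
  open ≡-Reasoning
  H : ℕ → Series
  H k = ∏[ k ] (λ i → inv (𝟏 ⊖ (X^ i)))
  low : ∀ k → k ≤ n → ((+ (k + 1)) · (X^ k) ⊛ H k) n ≡ + (length (staircases 0 k (n ∸ k)) * suc k)
  low k k≤n = begin
    ((+ (k + 1)) · (X^ k) ⊛ H k) n       ≡⟨ shifted (+ (k + 1)) k (H k) n ⟩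
    _                                    ≡⟨ X^-pick k n (λ i → + (k + 1) ℤ.* H k (n ∸ i)) k≤n ⟩
    + (k + 1) ℤ.* H k (n ∸ k)            ≡⟨ cong (+ (k + 1) ℤ.*_) (∏-geometric 0 k (suc ∘ toℕ) (λ _ → refl) (n ∸ k)) ⟩
    + (k + 1) ℤ.* + length (staircases 0 k (n ∸ k))  ≡⟨ ℤ.pos-* (k + 1) _ ⟨
    + ((k + 1) * length (staircases 0 k (n ∸ k)))    ≡⟨ cong +_ (trans (*-comm (k + 1) _) (cong (length (staircases 0 k (n ∸ k)) *_) (+-comm k 1))) ⟩
    + (length (staircases 0 k (n ∸ k)) * suc k)      ∎

proposition5p8 : (∀ k n → n ≥ k + 2 →
    ∃ λ m → HasSize (Av n k (p1324 ∷ p1432 ∷ [])) m × HasSize (BlueAboveRed k) m)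
    ×
    (∃ λ (c : ℕ → ℕ) →
    IsLimitSequence (p1324 ∷ p1432 ∷ []) c ×
    (λ k → (+ (k + 1)) · (X^ k) ⊛ (∏[ k ] (λ i → inv (𝟏 ⊖ (X^ i))))) SumsTo generatingFunction c)
proposition5p8 =
  (λ k n k+2≤n → count k , Av-size k n k+2≤n , BlueAboveRed-size k) ,
  count , (λ k → k + 2 , Av-size k) , count-series
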